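{- Let $\mathcal{A}$ be a finite Abelian group, $p$ a prime, $k\ge1$, and $t:\mathcal{A}^3\to\mathbb{Z}_{p^k}$. Let $N$ be the minimal positive integer for which there are functions $a,b,c:\mathcal{A}\to\mathbb{Z}_{p^kN}$ with $a(x)+b(y)+c(z)=N\cdot t(x,y,z)\pmod{p^kN}$ for all $(x,y,z)\in\mathcal{A}^3$ with $x+y+z=0$, and suppose such $N$ exists and $N>1$. Then there is a constant $c=c(t,\mathcal{A})>0$ such that for all $n$ and all $f,g,h:\mathcal{A}^n\to\mathbb{Z}_{p^k}^n$, $$\Pr_{\substack{(x,y,z)\in(\mathcal{A}^n)^3\\ x+y+z=0}}\big[f(x)_i+g(y)_i+h(z)_i=t(x_i,y_i,z_i)\pmod{p^k},\ i=1,\dots,n\big]\le 2^{ -cn},$$ where $(x,y,z)$ is uniform among triples in $(\mathcal{A}^n)^3$ with $x+y+z=0$. -}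

module Defs where

open import Level using (Level; suc)
open import Algebra.Bundles using (AbelianGroup)
open import Algebra.Structures using (IsAbelianGroup)
open import Algebra.Definitions.RawSemiring using () renaming (_^_ to pow)
open import Data.Fin using (Fin; toℕ)
open import Data.Fin.Properties using (all?) renaming (_≟_ to _≟ᶠ_)
open import Data.Integer using (+_; ∣_∣)
open import Data.List using (List; []; _∷_; map; filter; length; allFin; cartesianProduct; cartesianProductWith)
open import Data.List.Membership.Propositional using (_∈_)
open import Data.List.Membership.Propositional.Properties
  using (∈-map⁺; ∈-allFin; ∈-filter⁺; ∈-cartesianProduct⁺; ∈-cartesianProductWith⁺)
open import Data.List.Relation.Unary.Any using (here)
open import Data.Nat as ℕ using (ℕ; zero; ∣_-_∣; NonZero)
open import Data.Nat.Divisibility using (_∣_; _∣?_)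
open import Data.Product using (_×_; _,_; Σ-syntax)
open import Data.Rational as ℚ using (ℚ; _/_; 1ℚ; ↥_; ↧ₙ_)
open import Data.Rational.Properties using (+-*-rawSemiring)
open import Data.Vec using (Vec; []; _∷_; lookup; zipWith; replicate)
open import Data.Vec.Properties using (≡-dec)
open import Function using (_↔_; module Inverse)
open import Function.Properties.Inverse using (↔⇒↣)
open import Relation.Binary.Definitions using (DecidableEquality)
open import Relation.Binary.PropositionalEquality using (_≡_; refl; cong; cong₂; subst; trans)
open import Relation.Nullary.Decidable using (via-injection)
open import Relation.Unary using (Pred; Decidable)

record FiniteAbelianGroup (a : Level) : Set (suc a) where
  infixl 7 _⊕_
  infix 8 ⊖_
  field
    Carrier        : Set a
    _⊕_            : Carrier → Carrier → Carrier
    0#             : Carrier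
    ⊖_             : Carrier → Carrier
    isAbelianGroup : IsAbelianGroup _≡_ _⊕_ 0# ⊖_
    order          : ℕ
    finite         : Carrier ↔ Fin order

  abelianGroup : AbelianGroup a a
  abelianGroup = record { isAbelianGroup = isAbelianGroup }

  _≟_ : DecidableEquality Carrier
  _≟_ = via-injection (↔⇒↣ finite) _≟ᶠ_

  elements : List Carrier
  elements = map (Inverse.from finite) (allFin order)

  ∈-elements : ∀ x → x ∈ elements
  ∈-elements x = subst (_∈ elements) (Inverse.strictlyInverseʳ finite x)
    (∈-map⁺ (Inverse.from finite) (∈-allFin (Inverse.to finite x)))

-- ℤ/M, through the representatives 0, …, M-1.  Sums of residues are formed in ℕ
-- on representatives and compared with  _≡_[mod_] .
ℤ/ : ℕ → Set
ℤ/ M = Fin M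

infix 4 _≡_[mod_]
_≡_[mod_] : ℕ → ℕ → ℕ → Set
l ≡ r [mod M ] = M ∣ ∣ l - r ∣

-- Probability under the uniform distribution on the entries of a list
-- (used below for a list without repetitions).
Pr : ∀ {a q} {A : Set a} {P : Pred A q} (Ω : List A) .{{_ : NonZero (length Ω)}} →
     Decidable P → ℚ
Pr Ω P? = + length (filter P? Ω) / length Ω

-- For rational c = u/v > 0 and r ≥ 0:  r ≤ 2^(-cn)  iff  r^v · 2^(un) ≤ 1.
-- A real c > 0 in such a bound may always be replaced by a smaller rational one.
-- Only meaningful for c ≥ 0, since the sign of the numerator is dropped.
infix 4 _≤2^-[_·_]
_≤2^-[_·_] : ℚ → ℚ → ℕ → Set
r ≤2^-[ c · n ] =
  pow +-*-rawSemiring r (↧ₙ c) ℚ.* (+ (2 ℕ.^ (∣ ↥ c ∣ ℕ.* n)) / 1) ℚ.≤ 1ℚ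

module _ {a : Level} (𝒜 : FiniteAbelianGroup a) where
  open FiniteAbelianGroup 𝒜

  -- t is used only through its values at triples with x + y + z = 0.
  Solvable : (q : ℕ) → (Carrier → Carrier → Carrier → ℤ/ q) → ℕ → Set a
  Solvable q t N =
    Σ[ α ∈ (Carrier → ℤ/ (q ℕ.* N)) ]
    Σ[ β ∈ (Carrier → ℤ/ (q ℕ.* N)) ]
    Σ[ γ ∈ (Carrier → ℤ/ (q ℕ.* N)) ]
      (∀ x y z → x ⊕ y ⊕ z ≡ 0# →
        toℕ (α x) ℕ.+ toℕ (β y) ℕ.+ toℕ (γ z) ≡ N ℕ.* toℕ (t x y z) [mod q ℕ.* N ])

  IsMinimalSolvable : (q : ℕ) → (Carrier → Carrier → Carrier → ℤ/ q) → ℕ → Set a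
  IsMinimalSolvable q t N =
    0 ℕ.< N × Solvable q t N × (∀ M → 0 ℕ.< M → Solvable q t M → N ℕ.≤ M)

  Triple : ℕ → Set a
  Triple n = Vec Carrier n × Vec Carrier n × Vec Carrier n

  vectors : ∀ n → List (Vec Carrier n)
  vectors zero      = [] ∷ []
  vectors (ℕ.suc n) = cartesianProductWith _∷_ elements (vectors n)

  ZeroSum : ∀ n → Pred (Triple n) a
  ZeroSum n (x , y , z) = zipWith _⊕_ (zipWith _⊕_ x y) z ≡ replicate n 0#

  zeroSum? : ∀ n → Decidable (ZeroSum n)
  zeroSum? n (x , y , z) = ≡-dec _≟_ _ _

  zeroSumTriples : ∀ n → List (Triple n)
  zeroSumTriples n =
    filter (zeroSum? n) (cartesianProduct (vectors n) (cartesianProduct (vectors n) (vectors n)))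

  ∈-vectors : ∀ {n} (x : Vec Carrier n) → x ∈ vectors n
  ∈-vectors []       = here refl
  ∈-vectors (x ∷ xs) = ∈-cartesianProductWith⁺ _∷_ (∈-elements x) (∈-vectors xs)

  ∈-zeroSumTriples : ∀ {n} (w : Triple n) → ZeroSum n w → w ∈ zeroSumTriples n
  ∈-zeroSumTriples {n} (x , y , z) =
    ∈-filter⁺ (zeroSum? n)
      (∈-cartesianProduct⁺ (∈-vectors x) (∈-cartesianProduct⁺ (∈-vectors y) (∈-vectors z)))

  zeroSum-0 : ∀ n → ZeroSum n (replicate n 0# , replicate n 0# , replicate n 0#)
  zeroSum-0 zero      = refl
  zeroSum-0 (ℕ.suc n) = cong₂ _∷_
    (trans (cong (_⊕ 0#) (identityˡ 0#)) (identityˡ 0#)) (zeroSum-0 n)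
    where open IsAbelianGroup isAbelianGroup using (identityˡ)

  ∈⇒nonZero : ∀ {b} {B : Set b} {w : B} {ws : List B} → w ∈ ws → NonZero (length ws)
  ∈⇒nonZero {ws = _ ∷ _} _ = _

  instance
    zeroSumTriples-nonZero : ∀ {n} → NonZero (length (zeroSumTriples n))
    zeroSumTriples-nonZero {n} = ∈⇒nonZero (∈-zeroSumTriples _ (zeroSum-0 n))

  module _ {q : ℕ} (t : Carrier → Carrier → Carrier → ℤ/ q) {n : ℕ}
           (f g h : Vec Carrier n → Vec (ℤ/ q) n) where

    Wins : Pred (Triple n) _
    Wins (x , y , z) = ∀ (i : Fin n) →
      toℕ (lookup (f x) i) ℕ.+ toℕ (lookup (g y) i) ℕ.+ toℕ (lookup (h z) i)
        ≡ toℕ (t (lookup x i) (lookup y i) (lookup z i)) [mod q ]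

    wins? : Decidable Wins
    wins? (x , y , z) = all? λ i → q ∣? _

    winProbability : ℚ
    winProbability = Pr (zeroSumTriples n) {{zeroSumTriples-nonZero {n}}} wins?

{-# OPTIONS --safe #-}

-- Put q = p ^ k.  Modulo N the functions a, b, c solve the homogeneous equation, so
-- α x = a x - a 0 is additive modulo N; minimality of N > 1 says that α has no additive lift modulo
-- qN, and this happens only if some e with q e = 0 has N ∤ α e.  Restrict the game to the shifts of
-- a question by multiples of e, indexed by G = (ℤ/q)ⁿ, and replace f by i ↦ (i , N f - a), viewed
-- in (ℤ/q × ℤ/qN)ⁿ, and likewise g and h.  A win becomes F + G + H = 0, and the coordinates of F
-- modulo N are known: they are affine in i with slope - α e.
--
-- Suppose a fraction ε of the triples win.  Cauchy–Schwarz arguments produce ε^O(1) |G|^(2q+2) chains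
-- a₀ – y₁ – a₁′, a₁ – y₂ – a₂′, …, a_q in which consecutive vertices are joined by two winning triples
-- and all the differences F a_i - F a_i′ have a common value v.  The 2q third vertices of these triples
-- and a_q determine the sum F a₀ + q v, hence the label a₀ and q v, hence the value of α on the
-- label of v; the latter is shared by at most 2^(-n) |G| labels.  So there are at most
-- 2^(-n) |G|^(2q+2) chains, and ε^O(1) ≤ 2^(-n).
module Submission where

open import Defs
open import Level using (Level)
open import Data.Nat using (ℕ; suc; _^_; _≤_; _<_)
open import Data.Nat.Primality using (Prime)
open import Data.Product using (_×_; _,_; Σ-syntax)
open import Data.Rational as ℚ using (ℚ; 0ℚ)
open import Data.Vec using (Vec)

-- If all triples of labels with i + j + l = 0 won, `F` would be affine on G. Its slope in each
-- direction, having order dividing q in ℤ/qN, would be a multiple of N, whereas modulo N it is - α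
-- e. The proof makes this contradiction robust. Since ε may itself be exponentially small in n,
-- every loss has to be a power of ε with exponent free of n; hence only Cauchy-Schwarz and counting
-- are used, and no large subset on which `F` is affine is ever extracted.
--
-- The number q of differences in a chain is dictated by two effects of multiplication by q: it
-- kills the coordinate in ℤ/q, so that F a₀ + q v still shows the label of a₀, and it turns a value
-- modulo qN into a value modulo N, the only part of the second coordinate that is known as a
-- function of the label.
--
-- Repeated squaring reaches chains whose length is a power of two. Chains of 2 ^ q steps are
-- therefore counted from below and cut to q steps by the trivial degree bound. With the three
-- squarings that come before, the exponent of ε is 8 · 2 ^ q, and c is its reciprocal.

module Counting where

  -- Finite sums over lists, indicators and Cauchy-Schwarz in ℕ.

  open import Level using (Level)
  open import Data.Nat using (ℕ; zero; suc; _+_; _*_; _^_; _∸_; _≤_; _<_; z≤n; s≤s)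
  open import Data.Nat.Properties
  open import Data.Nat.ListAction using (sum)
  open import Data.Nat.ListAction.Properties using (sum-++)
  open import Data.Nat.Tactic.RingSolver using (solve; solve-∀)
  open import Data.List using (List; []; _∷_; _++_; map; filter; length; cartesianProduct; cartesianProductWith)
  open import Data.List.Properties using (map-++; map-∘; map-cong; length-++; length-map)
  open import Data.List.Membership.Propositional using (_∈_)
  open import Data.List.Relation.Unary.Any using (here; there)
  open import Data.Product using (_×_; _,_; proj₁; proj₂; ∃)
  open import Data.Sum using (_⊎_; inj₁; inj₂)
  open import Function using (_∘_)
  open import Relation.Nullary using (Dec; yes; no; contradiction)
  open import Relation.Unary using (Pred; Decidable)
  open import Relation.Binary.PropositionalEquality

  private variable
    ℓa ℓb ℓp ℓq : Level
    A : Set ℓa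
    B : Set ℓb
    P : Set ℓp
    Q : Set ℓq

  ∑ : List A → (A → ℕ) → ℕ
  ∑ xs f = sum (map f xs)

  infix 5 ∑-syntax
  ∑-syntax : List A → (A → ℕ) → ℕ
  ∑-syntax = ∑
  syntax ∑-syntax xs (λ x → e) = ∑[ x ∈ xs ] e

  χ : Dec P → ℕ
  χ (yes _) = 1
  χ (no  _) = 0

  χ≤1 : (d : Dec P) → χ d ≤ 1
  χ≤1 (yes _) = ≤-refl
  χ≤1 (no  _) = z≤n

  χ-yes : (d : Dec P) → P → χ d ≡ 1
  χ-yes (yes _) _ = refl
  χ-yes (no ¬p) p = contradiction p ¬p

  χ-mono : (d : Dec P) (e : Dec Q) → (P → Q) → χ d ≤ χ e
  χ-mono (yes p) e f = ≤-reflexive (sym (χ-yes e (f p)))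
  χ-mono (no  _) e f = z≤n

  -- Under the factor χ d, P may be assumed. Nested uses recover from a product of indicators the
  -- equations that it encodes.
  χ-guard : (d : Dec P) {m n : ℕ} → (P → m ≤ n) → χ d * m ≤ χ d * n
  χ-guard (yes p) f = *-monoʳ-≤ 1 (f p)
  χ-guard (no  _) f = z≤n

  ∑-cong : (xs : List A) {f g : A → ℕ} → (∀ x → f x ≡ g x) → ∑ xs f ≡ ∑ xs g
  ∑-cong xs h = cong sum (map-cong h xs)

  ∑-mono : (xs : List A) {f g : A → ℕ} → (∀ x → f x ≤ g x) → ∑ xs f ≤ ∑ xs g
  ∑-mono []       h = z≤n
  ∑-mono (x ∷ xs) h = +-mono-≤ (h x) (∑-mono xs h)

  ∑-*ˡ : ∀ c (xs : List A) (f : A → ℕ) → c * ∑ xs f ≡ ∑[ x ∈ xs ] c * f x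
  ∑-*ˡ c []       f = *-zeroʳ c
  ∑-*ˡ c (x ∷ xs) f = trans (*-distribˡ-+ c (f x) _) (cong (c * f x +_) (∑-*ˡ c xs f))

  ∑-*ʳ : ∀ (xs : List A) (f : A → ℕ) c → ∑ xs f * c ≡ ∑[ x ∈ xs ] f x * c
  ∑-*ʳ []       f c = refl
  ∑-*ʳ (x ∷ xs) f c = trans (*-distribʳ-+ c (f x) _) (cong (f x * c +_) (∑-*ʳ xs f c))

  ∑-+ : ∀ (xs : List A) (f g : A → ℕ) → (∑[ x ∈ xs ] f x + g x) ≡ ∑ xs f + ∑ xs g
  ∑-+ []       f g = refl
  ∑-+ (x ∷ xs) f g = trans (cong (f x + g x +_) (∑-+ xs f g))
    (interchange (f x) (g x) (∑ xs f) (∑ xs g))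
    where
    interchange : ∀ k l m n → k + l + (m + n) ≡ k + m + (l + n)
    interchange = solve-∀

  ∑-zero : (xs : List A) → (∑[ _ ∈ xs ] 0) ≡ 0
  ∑-zero []       = refl
  ∑-zero (_ ∷ xs) = ∑-zero xs

  ∑-const : ∀ (xs : List A) c → (∑[ _ ∈ xs ] c) ≡ length xs * c
  ∑-const []       c = refl
  ∑-const (_ ∷ xs) c = cong (c +_) (∑-const xs c)

  ∑-bound : ∀ (xs : List A) {f : A → ℕ} {c} → (∀ x → f x ≤ c) → ∑ xs f ≤ length xs * c
  ∑-bound xs {c = c} h = ≤-trans (∑-mono xs h) (≤-reflexive (∑-const xs c))

  ∑-swap : ∀ (xs : List A) (ys : List B) (f : A → B → ℕ) →
    (∑[ x ∈ xs ] ∑[ y ∈ ys ] f x y) ≡ (∑[ y ∈ ys ] ∑[ x ∈ xs ] f x y)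
  ∑-swap []       ys f = sym (∑-zero ys)
  ∑-swap (x ∷ xs) ys f = trans (cong (∑ ys (f x) +_) (∑-swap xs ys f)) (sym (∑-+ ys (f x) _))

  ∑-∈ : ∀ {xs : List A} {x} (f : A → ℕ) → x ∈ xs → f x ≤ ∑ xs f
  ∑-∈ f (here refl) = m≤m+n _ _
  ∑-∈ f (there x∈)  = ≤-trans (∑-∈ f x∈) (m≤n+m _ _)

  ∑-++ : ∀ (xs ys : List A) (f : A → ℕ) → ∑ (xs ++ ys) f ≡ ∑ xs f + ∑ ys f
  ∑-++ xs ys f = trans (cong sum (map-++ f xs ys)) (sum-++ (map f xs) (map f ys))

  ∑-map : ∀ (g : A → B) (xs : List A) (f : B → ℕ) → ∑ (map g xs) f ≡ ∑ xs (f ∘ g)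
  ∑-map g xs f = cong sum (sym (map-∘ xs))

  ∑-cartesianWith : ∀ {c} {C : Set c} (_·_ : A → B → C) xs ys (f : C → ℕ) →
    ∑ (cartesianProductWith _·_ xs ys) f ≡ (∑[ x ∈ xs ] ∑[ y ∈ ys ] f (x · y))
  ∑-cartesianWith _·_ []       ys f = refl
  ∑-cartesianWith _·_ (x ∷ xs) ys f = trans (∑-++ (map (x ·_) ys) _ f)
    (cong₂ _+_ (∑-map (x ·_) ys f) (∑-cartesianWith _·_ xs ys f))

  ∑-cartesian : ∀ (xs : List A) (ys : List B) (f : A × B → ℕ) →
    ∑ (cartesianProduct xs ys) f ≡ (∑[ x ∈ xs ] ∑[ y ∈ ys ] f (x , y))
  ∑-cartesian = ∑-cartesianWith _,_

  ∑-cartesian-* : ∀ (xs : List A) (ys : List B) (f : A → ℕ) (g : B → ℕ) →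
    (∑[ p ∈ cartesianProduct xs ys ] f (proj₁ p) * g (proj₂ p)) ≡ ∑ xs f * ∑ ys g
  ∑-cartesian-* xs ys f g = begin
    _                                     ≡⟨ ∑-cartesian xs ys _ ⟩
    (∑[ x ∈ xs ] ∑[ y ∈ ys ] f x * g y)   ≡⟨ ∑-cong xs (λ x → ∑-*ˡ (f x) ys g) ⟨
    (∑[ x ∈ xs ] f x * ∑ ys g)            ≡⟨ ∑-*ʳ xs f _ ⟨
    ∑ xs f * ∑ ys g                       ∎
    where open ≡-Reasoning

  length-cartesian : ∀ (xs : List A) (ys : List B) →
    length (cartesianProduct xs ys) ≡ length xs * length ys
  length-cartesian []       ys = refl
  length-cartesian (x ∷ xs) ys = trans (length-++ (map (x ,_) ys))
    (cong₂ _+_ (length-map (x ,_) ys) (length-cartesian xs ys))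

  length-filter-∑ : ∀ {P : Pred A ℓp} (P? : Decidable P) xs → length (filter P? xs) ≡ ∑ xs (χ ∘ P?)
  length-filter-∑ P? []       = refl
  length-filter-∑ P? (x ∷ xs) with P? x
  ... | yes _ = cong suc (length-filter-∑ P? xs)
  ... | no  _ = length-filter-∑ P? xs

  ∑-filter : ∀ {P : Pred A ℓp} (P? : Decidable P) xs (f : A → ℕ) →
    ∑ (filter P? xs) f ≡ (∑[ x ∈ xs ] χ (P? x) * f x)
  ∑-filter P? []       f = refl
  ∑-filter P? (x ∷ xs) f with P? x
  ... | yes _ = cong₂ _+_ (sym (+-identityʳ (f x))) (∑-filter P? xs f)
  ... | no  _ = ∑-filter P? xs f

  ∑χ-any : ∀ {P : Pred A ℓp} (P? : Decidable P) xs →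
    ∑ xs (χ ∘ P?) ≡ 0 ⊎ ∃ P
  ∑χ-any P? [] = inj₁ refl
  ∑χ-any P? (x ∷ xs) with P? x
  ... | yes p = inj₂ (x , p)
  ... | no  _ = ∑χ-any P? xs

  sq-≤⇒≤ : ∀ {m n} → m * m ≤ n * n → m ≤ n
  sq-≤⇒≤ {m} {n} h with ≤-total m n
  ... | inj₁ m≤n = m≤n
  ... | inj₂ n≤m with m≤n⇒m<n∨m≡n n≤m
  ...   | inj₂ n≡m = ≤-reflexive (sym n≡m)
  ...   | inj₁ n<m = contradiction h (<⇒≱ (*-mono-< n<m n<m))

  private
    4uv≤[u+v]² : ∀ u v → 4 * (u * v) ≤ (u + v) * (u + v)
    4uv≤[u+v]² u v with ≤-total u v
    ... | inj₁ u≤v = subst (λ v → 4 * (u * v) ≤ (u + v) * (u + v)) (m+[n∸m]≡n u≤v) (lemma u (v ∸ u))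
      where
      id : ∀ u d → (u + (u + d)) * (u + (u + d)) ≡ 4 * (u * (u + d)) + d * d
      id = solve-∀
      lemma : ∀ u d → 4 * (u * (u + d)) ≤ (u + (u + d)) * (u + (u + d))
      lemma u d = subst (4 * (u * (u + d)) ≤_) (sym (id u d)) (m≤m+n _ _)
    ... | inj₂ v≤u = subst (λ u → 4 * (u * v) ≤ (u + v) * (u + v)) (m+[n∸m]≡n v≤u) (lemma v (u ∸ v))
      where
      id : ∀ v d → ((v + d) + v) * ((v + d) + v) ≡ 4 * ((v + d) * v) + d * d
      id = solve-∀
      lemma : ∀ v d → 4 * ((v + d) * v) ≤ ((v + d) + v) * ((v + d) + v)
      lemma v d = subst (4 * ((v + d) * v) ≤_) (sym (id v d)) (m≤m+n _ _)

  -- A pointwise bound by a product of weights replaces square roots, so everything stays in ℕ. In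
  -- the induction the cross term is handled by the inequality of arithmetic and geometric means.
  cauchy-schwarz : ∀ (xs : List A) {f u v : A → ℕ} → (∀ x → f x * f x ≤ u x * v x) →
    ∑ xs f * ∑ xs f ≤ ∑ xs u * ∑ xs v
  cauchy-schwarz []       h = z≤n
  cauchy-schwarz (x ∷ xs) {f} {u} {v} h = step (f x) (u x) (v x) (∑ xs f) (∑ xs u) (∑ xs v) (h x)
    (cauchy-schwarz xs {f} {u} {v} h)
    where
    cross : ∀ a b c d e g → a * a ≤ b * c → d * d ≤ e * g → 2 * (a * d) ≤ b * g + e * c
    cross a b c d e g p q = sq-≤⇒≤ {2 * (a * d)} {b * g + e * c} (begin
      2 * (a * d) * (2 * (a * d))             ≡⟨ solve (a ∷ d ∷ []) ⟩
      4 * ((a * a) * (d * d))                 ≤⟨ *-monoʳ-≤ 4 (*-mono-≤ p q) ⟩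
      4 * ((b * c) * (e * g))                 ≡⟨ solve (b ∷ c ∷ e ∷ g ∷ []) ⟩
      4 * ((b * g) * (e * c))                 ≤⟨ 4uv≤[u+v]² (b * g) (e * c) ⟩
      (b * g + e * c) * (b * g + e * c)       ∎)
      where open ≤-Reasoning
    step : ∀ a b c d e g → a * a ≤ b * c → d * d ≤ e * g → (a + d) * (a + d) ≤ (b + e) * (c + g)
    step a b c d e g p q = begin
      (a + d) * (a + d)                       ≡⟨ solve (a ∷ d ∷ []) ⟩
      a * a + 2 * (a * d) + d * d             ≤⟨ +-mono-≤ (+-mono-≤ p (cross a b c d e g p q)) q ⟩
      b * c + (b * g + e * c) + e * g         ≡⟨ solve (b ∷ c ∷ e ∷ g ∷ []) ⟩
      (b + e) * (c + g)                       ∎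
      where open ≤-Reasoning

  power-mean : ∀ (xs : List A) (f : A → ℕ) → ∑ xs f * ∑ xs f ≤ (∑[ x ∈ xs ] f x * f x) * length xs
  power-mean xs f = ≤-trans
    (cauchy-schwarz xs {v = λ _ → 1} (λ x → ≤-reflexive (sym (*-identityʳ _))))
    (*-monoʳ-≤ (∑[ x ∈ xs ] f x * f x) (≤-reflexive (trans (∑-const xs 1) (*-identityʳ _))))

  ^-distribʳ-* : ∀ k m n → (m * n) ^ k ≡ m ^ k * n ^ k
  ^-distribʳ-* zero    m n = refl
  ^-distribʳ-* (suc k) m n = trans (cong (m * n *_) (^-distribʳ-* k m n)) (regroup m n (m ^ k) (n ^ k))
    where
    regroup : ∀ m n a b → m * n * (a * b) ≡ m * a * (n * b)
    regroup = solve-∀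

  n<2^n : ∀ n → n < 2 ^ n
  n<2^n zero    = s≤s z≤n
  n<2^n (suc n) = begin-strict
    suc n          ≤⟨ n<2^n n ⟩
    2 ^ n          <⟨ m<m+n (2 ^ n) (m^n>0 2 n) ⟩
    2 ^ n + 2 ^ n  ≡⟨ cong (2 ^ n +_) (+-identityʳ (2 ^ n)) ⟨
    2 ^ suc n      ∎
    where open ≤-Reasoning

  χ-≤-* : {R : Set ℓa} (c : Dec R) (d : Dec P) (e : Dec Q) → (R → P) → (R → Q) → χ c ≤ χ d * χ e
  χ-≤-* (no _)  d e f g = z≤n
  χ-≤-* (yes r) d e f g = ≤-reflexive (sym (cong₂ _*_ (χ-yes d (f r)) (χ-yes e (g r))))

open Counting

module AdditiveCombinatorics where

  open import Level using (Level)
  open import Algebra.Bundles using (AbelianGroup)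
  open import Data.Nat using (ℕ; zero; suc; _+_; _*_; _^_; _∸_; _≤_; z≤n; s≤s; NonZero)
  open import Data.Nat.Properties
  open import Data.Nat.Tactic.RingSolver using (solve-∀)
  open import Data.List using (List; []; _∷_; map; length; cartesianProduct)
  open import Data.List.Membership.Propositional using (_∈_)
  open import Data.List.Membership.Propositional.Properties using (∈-cartesianProduct⁺; ∈-map⁺)
  open import Data.List.Relation.Unary.Any using (here; there)
  open import Data.Product using (_×_; _,_; proj₁; proj₂)
  open import Relation.Nullary using (yes; no)
  open import Relation.Binary.Definitions using () renaming (Decidable to Decidable₂)
  open import Relation.Binary.PropositionalEquality using (_≡_; refl; sym; trans; cong; cong₂; subst; module ≡-Reasoning)

  private variable
    ℓa : Level

  -- Walk counts of a symmetric kernel.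

  module Walks {A : Set ℓa} (P : List A) (K : A → A → ℕ) (K-sym : ∀ α β → K α β ≡ K β α) where

    private n = length P

    apply : (A → ℕ) → A → ℕ
    apply f α = ∑[ β ∈ P ] K α β * f β

    walk : ℕ → A → ℕ
    walk zero    _ = 1
    walk (suc i) = apply (walk i)

    walks : ℕ → ℕ
    walks i = ∑ P (walk i)

    apply-selfAdjoint : ∀ f g → (∑[ α ∈ P ] f α * apply g α) ≡ (∑[ α ∈ P ] apply f α * g α)
    apply-selfAdjoint f g = begin
      (∑[ α ∈ P ] f α * apply g α)                   ≡⟨ ∑-cong P (λ α → ∑-*ˡ (f α) P _) ⟩
      (∑[ α ∈ P ] ∑[ β ∈ P ] f α * (K α β * g β))    ≡⟨ ∑-swap P P _ ⟩
      (∑[ β ∈ P ] ∑[ α ∈ P ] f α * (K α β * g β))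
        ≡⟨ ∑-cong P (λ β → ∑-cong P (λ α → trans (cong (λ k → f α * (k * g β)) (K-sym α β))
             (move (f α) (K β α) (g β)))) ⟩
      (∑[ β ∈ P ] ∑[ α ∈ P ] K β α * f α * g β)      ≡⟨ ∑-cong P (λ β → ∑-*ʳ P _ (g β)) ⟨
      (∑[ β ∈ P ] apply f β * g β)                   ∎
      where
      open ≡-Reasoning
      move : ∀ a k b → a * (k * b) ≡ k * a * b
      move = solve-∀

    -- Self-adjointness moves steps from one factor to the other. With i = j, a sum of squares
    -- becomes a count of walks of twice the length.
    walk-inner : ∀ i j → (∑[ α ∈ P ] walk i α * walk j α) ≡ walks (i + j)
    walk-inner i zero    = trans (∑-cong P (λ α → *-identityʳ _)) (cong walks (sym (+-identityʳ i)))
    walk-inner i (suc j) = trans (apply-selfAdjoint (walk i) (walk j))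
      (trans (walk-inner (suc i) j) (cong walks (sym (+-suc i j))))

    walks-double : ∀ i → walks i * walks i ≤ walks (i + i) * n
    walks-double i = subst (λ w → walks i * walks i ≤ w * n) (walk-inner i i) (power-mean P (walk i))

    -- Iterated `walks-double`: there are at least as many walks as for a kernel of the same total
    -- weight with equal row sums. Doubling reaches only lengths that are powers of two.
    walks-power : ∀ j → n * walks 1 ^ (2 ^ j) ≤ n ^ (2 ^ j) * walks (2 ^ j)
    walks-power zero    = ≤-reflexive (cong₂ _*_ (sym (*-identityʳ n)) (*-identityʳ (walks 1)))
    walks-power (suc j) rewrite +-identityʳ (2 ^ j) = double n refl
      where
      J = 2 ^ j
      x = walks 1 ^ J
      -- The case n = 0 is split off because the inductive step cancels a factor n.
      double : ∀ k → n ≡ k → n * walks 1 ^ (J + J) ≤ n ^ (J + J) * walks (J + J)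
      double zero    n≡0 = subst (λ n → n * walks 1 ^ (J + J) ≤ length P ^ (J + J) * walks (J + J)) (sym n≡0) z≤n
      double (suc k) n≡  = *-cancelʳ-≤ _ _ n {{subst NonZero (sym n≡) _}} (begin
        n * walks 1 ^ (J + J) * n               ≡⟨ cong (λ w → n * w * n) (^-distribˡ-+-* (walks 1) J J) ⟩
        n * (x * x) * n                         ≡⟨ square n x ⟩
        (n * x) * (n * x)                       ≤⟨ *-mono-≤ (walks-power j) (walks-power j) ⟩
        (n ^ J * walks J) * (n ^ J * walks J)   ≡⟨ regroup (n ^ J) (walks J) ⟩
        n ^ J * n ^ J * (walks J * walks J)     ≤⟨ *-monoʳ-≤ (n ^ J * n ^ J) (walks-double J) ⟩
        n ^ J * n ^ J * (walks (J + J) * n)     ≡⟨ *-assoc (n ^ J * n ^ J) _ n ⟨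
        n ^ J * n ^ J * walks (J + J) * n       ≡⟨ cong (λ w → w * walks (J + J) * n) (^-distribˡ-+-* n J J) ⟨
        n ^ (J + J) * walks (J + J) * n         ∎)
        where
        open ≤-Reasoning
        square : ∀ n x → n * (x * x) * n ≡ (n * x) * (n * x)
        square = solve-∀
        regroup : ∀ a w → (a * w) * (a * w) ≡ a * a * (w * w)
        regroup = solve-∀

    -- Summing out the first vertex costs a column sum, which is a row sum by symmetry. This cuts
    -- walks of length 2 ^ m, supplied by `walks-power`, down to length m.
    walks-growth : ∀ {D} → (∀ α → (∑[ β ∈ P ] K α β) ≤ D) → ∀ l i → walks (l + i) ≤ D ^ l * walks i
    walks-growth rows zero    i = ≤-reflexive (sym (+-identityʳ _))
    walks-growth {D} rows (suc l) i = begin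
      walks (suc l + i)                                      ≡⟨ ∑-swap P P _ ⟩
      (∑[ β ∈ P ] ∑[ α ∈ P ] K α β * walk (l + i) β)         ≡⟨ ∑-cong P (λ β → ∑-*ʳ P _ (walk (l + i) β)) ⟨
      (∑[ β ∈ P ] (∑[ α ∈ P ] K α β) * walk (l + i) β)
        ≤⟨ ∑-mono P (λ β → *-monoˡ-≤ (walk (l + i) β)
             (≤-trans (≤-reflexive (∑-cong P (λ α → K-sym α β))) (rows β))) ⟩
      (∑[ β ∈ P ] D * walk (l + i) β)                        ≡⟨ ∑-*ˡ D P _ ⟨
      D * walks (l + i)                                      ≤⟨ *-monoʳ-≤ D (walks-growth rows l i) ⟩
      D * (D ^ l * walks i)                                  ≡⟨ *-assoc D _ _ ⟨
      D ^ suc l * walks i                                    ∎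
      where open ≤-Reasoning

  -- Zero sums of three injective maps into an abelian group.

  module AdditiveTriples {c ℓ} (V : AbelianGroup c ℓ) (_≈?_ : Decidable₂ (AbelianGroup._≈_ V)) where

    open AbelianGroup V renaming (refl to ≈-refl; sym to ≈-sym; trans to ≈-trans)
    open import Algebra.Properties.AbelianGroup V
    open import Algebra.Properties.CommutativeMonoid.Mult commutativeMonoid
      using () renaming (_×_ to _·_; ×-congʳ to ·-congʳ) public
    open import Algebra.Solver.CommutativeMonoid commutativeMonoid as CM
      using (_⊕_; _⊜_)
    import Relation.Binary.Reasoning.Setoid setoid as ≈-R

    cross⇒difference : ∀ {x y z w} → x ∙ w ≈ z ∙ y → x - y ≈ z - w
    cross⇒difference {x} {y} {z} {w} h = begin
      x - y                     ≈⟨ ∙-congʳ (//-rightDividesʳ w x) ⟨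
      (x ∙ w) - w - y           ≈⟨ ∙-congʳ (∙-congʳ h) ⟩
      (z ∙ y) - w - y           ≈⟨ CM.solve 4 (λ z y w⁻¹ y⁻¹ → ((z ⊕ y) ⊕ w⁻¹) ⊕ y⁻¹ ⊜ ((z ⊕ w⁻¹) ⊕ y) ⊕ y⁻¹) ≈-refl z y (w ⁻¹) (y ⁻¹) ⟩
      (z - w) ∙ y - y           ≈⟨ //-rightDividesʳ y (z - w) ⟩
      z - w                     ∎
      where open ≈-R

    -- Equality in `V` is only an equivalence relation, so a sum over the values of a map needs one
    -- representative of each class. A new w is added only when nothing in the list so far is equal
    -- to it.
    representatives : (ws : List Carrier) → Σ[ vs ∈ List Carrier ]
      ((∀ w → (∑[ v ∈ vs ] χ (w ≈? v)) ≤ 1) × (∀ {w} → w ∈ ws → 1 ≤ (∑[ v ∈ vs ] χ (w ≈? v))))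
    representatives []       = [] , (λ _ → z≤n) , λ ()
    representatives (w ∷ ws) with representatives ws
    ... | vs , unique , covers with ∑[ v ∈ vs ] χ (w ≈? v) in eq
    ...   | suc _ = vs , unique , λ { (here refl) → subst (1 ≤_) (sym eq) (s≤s z≤n) ; (there w∈) → covers w∈ }
    ...   | zero  = w ∷ vs , unique′ , λ
      { (here refl) → ≤-trans (≤-reflexive (sym (χ-yes (w ≈? w) ≈-refl))) (m≤m+n _ _)
      ; (there w∈)  → ≤-trans (covers w∈) (m≤n+m _ _) }
      where
      unique′ : ∀ u → (∑[ v ∈ w ∷ vs ] χ (u ≈? v)) ≤ 1
      unique′ u with u ≈? w
      ... | no _    = unique u
      ... | yes u≈w = s≤s (≤-trans (∑-mono vs (λ v → χ-mono (u ≈? v) (w ≈? v) (≈-trans (≈-sym u≈w))))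
                                   (≤-reflexive eq))

    -- Two zero sums with the same middle term y, which cancels. This exchanges differences of
    -- values of `F` for differences of values of `H`.
    zeroSum⇒difference : ∀ {x x′ y z z′} → x ∙ y ∙ z ≈ ε → x′ ∙ y ∙ z′ ≈ ε → x - x′ ≈ z′ - z
    zeroSum⇒difference {x} {x′} {y} {z} {z′} h h′ = cross⇒difference (∙-cancelʳ y _ _ (begin
      x ∙ z ∙ y      ≈⟨ CM.solve 3 (λ x z y → (x ⊕ z) ⊕ y ⊜ (x ⊕ y) ⊕ z) ≈-refl x z y ⟩
      x ∙ y ∙ z      ≈⟨ ≈-trans h (≈-sym h′) ⟩
      x′ ∙ y ∙ z′    ≈⟨ CM.solve 3 (λ x z y → (x ⊕ y) ⊕ z ⊜ (z ⊕ x) ⊕ y) ≈-refl x′ z′ y ⟩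
      z′ ∙ x′ ∙ y    ∎))
      where open ≈-R

    module _ {I : Set} (is : List I) (complete : ∀ i → i ∈ is) (F G H : I → Carrier)
      (F-inj : ∀ v → (∑[ i ∈ is ] χ (F i ≈? v)) ≤ 1)
      (G-inj : ∀ v → (∑[ i ∈ is ] χ (G i ≈? v)) ≤ 1)
      (H-inj : ∀ v → (∑[ i ∈ is ] χ (H i ≈? v)) ≤ 1) where

      M = length is

      zeroSums : ℕ
      zeroSums = ∑[ x ∈ is ] ∑[ y ∈ is ] ∑[ z ∈ is ] χ ((F x ∙ G y ∙ H z) ≈? ε)

      private
        P : List (I × I)
        P = cartesianProduct is is

        ∈-P : ∀ α → α ∈ P
        ∈-P (a , a′) = ∈-cartesianProduct⁺ (complete a) (complete a′)

        |P| : length P ≡ M * M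
        |P| = length-cartesian is is

        τ : I → I → I → ℕ
        τ x y z = χ ((F x ∙ G y ∙ H z) ≈? ε)

        τ-unique-x : ∀ y z → (∑[ x ∈ is ] τ x y z) ≤ 1
        τ-unique-x y z = ≤-trans (∑-mono is λ x → χ-mono _ (F x ≈? ((G y ∙ H z) ⁻¹))
          λ h → inverseˡ-unique _ _ (≈-trans (≈-sym (assoc _ _ _)) h)) (F-inj _)

        τ-unique-y : ∀ x z → (∑[ y ∈ is ] τ x y z) ≤ 1
        τ-unique-y x z = ≤-trans (∑-mono is λ y → χ-mono _ (G y ≈? ((F x ∙ H z) ⁻¹))
          λ h → inverseˡ-unique _ _ (≈-trans
            (CM.solve 3 (λ x y z → y ⊕ (x ⊕ z) ⊜ (x ⊕ y) ⊕ z) ≈-refl (F x) (G y) (H z)) h)) (G-inj _)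

        τ-unique-z : ∀ x y → (∑[ z ∈ is ] τ x y z) ≤ 1
        τ-unique-z x y = ≤-trans (∑-mono is λ z → χ-mono _ (H z ≈? ((F x ∙ G y) ⁻¹))
          λ h → inverseʳ-unique _ _ h) (H-inj _)

        -- By `τ-unique-z` this is 0 or 1: the edge indicator of a bipartite graph in which every
        -- edge carries a unique third vertex z.
        adj : I → I → ℕ
        adj x y = ∑[ z ∈ is ] τ x y z

        δ : I × I → Carrier
        δ (a , a′) = F a - F a′

        common : I × I → I → ℕ
        common (a , a′) y = adj a y * adj a′ y

        vs : List Carrier
        vs = proj₁ (representatives (map δ P))

        vs-unique : ∀ w → (∑[ v ∈ vs ] χ (w ≈? v)) ≤ 1
        vs-unique = proj₁ (proj₂ (representatives (map δ P)))

        vs-covers : ∀ α → 1 ≤ (∑[ v ∈ vs ] χ (δ α ≈? v))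
        vs-covers α = proj₂ (proj₂ (representatives (map δ P))) (∈-map⁺ δ (∈-P α))

        minuend-unique : ∀ v a′ → (∑[ a ∈ is ] χ (v ≈? (F a - F a′))) ≤ 1
        minuend-unique v a′ = ≤-trans (∑-mono is λ a → χ-mono _ (F a ≈? (v ∙ F a′))
          λ h → ≈-trans (≈-sym (//-rightDividesˡ (F a′) (F a))) (∙-congʳ (≈-sym h))) (F-inj _)

        class-bound : ∀ v → (∑[ α ∈ P ] χ (v ≈? δ α)) ≤ M
        class-bound v = begin
          (∑[ α ∈ P ] χ (v ≈? δ α))                          ≡⟨ trans (∑-cartesian is is _) (∑-swap is is _) ⟩
          (∑[ a′ ∈ is ] ∑[ a ∈ is ] χ (v ≈? (F a - F a′)))   ≤⟨ ∑-bound is (minuend-unique v) ⟩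
          M * 1                                              ≡⟨ *-identityʳ M ⟩
          M                                                  ∎
          where open ≤-Reasoning

        paths : ℕ
        paths = ∑[ α ∈ P ] ∑[ y ∈ is ] common α y

        -- Cauchy-Schwarz over the middle vertex y: `paths` is the sum of the squared degrees.
        zeroSums²≤ : zeroSums * zeroSums ≤ paths * M
        zeroSums²≤ = begin
          zeroSums * zeroSums                       ≡⟨ cong (λ s → s * s) (∑-swap is is adj) ⟩
          ∑ is deg * ∑ is deg                       ≤⟨ power-mean is deg ⟩
          (∑[ y ∈ is ] deg y * deg y) * M           ≡⟨ cong (_* M) (∑-cong is λ y → ∑-cartesian-* is is (λ a → adj a y) (λ a → adj a y)) ⟨
          (∑[ y ∈ is ] ∑[ α ∈ P ] common α y) * M   ≡⟨ cong (_* M) (∑-swap is P λ y α → common α y) ⟩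
          paths * M                                 ∎
          where
          open ≤-Reasoning
          deg : I → ℕ
          deg y = ∑[ x ∈ is ] adj x y

        n : Carrier → I → ℕ
        n v y = ∑[ α ∈ P ] χ (δ α ≈? v) * common α y

        -- ρ v counts the paths a — y — a′ in adj with F a - F a′ = v; r v and R v count the pairs
        -- realising the difference v in the images of F and H.
        ρ r R : Carrier → ℕ
        ρ v = ∑[ y ∈ is ] n v y
        r v = ∑[ α ∈ P ] χ (δ α ≈? v)
        R v = ∑[ ζ ∈ P ] χ ((H (proj₂ ζ) - H (proj₁ ζ)) ≈? v)

        ρ-alt : ∀ v → ρ v ≡ (∑[ α ∈ P ] χ (δ α ≈? v) * ∑ is (common α))
        ρ-alt v = trans (∑-swap is P _) (∑-cong P λ α → sym (∑-*ˡ (χ (δ α ≈? v)) is (common α)))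

        common-∑ : ∀ a b y → adj a y * adj b y ≡ (∑[ ζ ∈ P ] τ a y (proj₁ ζ) * τ b y (proj₂ ζ))
        common-∑ a b y = sym (∑-cartesian-* is is (τ a y) (τ b y))

        -- There are r v choices of the end points (a , a′). For each of them the third vertices (z
        -- , z′) realise v as a difference in `H`, and they determine the path because a and z
        -- determine y.
        ρ≤r*R : ∀ v → ρ v ≤ r v * R v
        ρ≤r*R v = begin
          ρ v                                                ≡⟨ ρ-alt v ⟩
          (∑[ α ∈ P ] χ (δ α ≈? v) * ∑ is (common α))        ≤⟨ ∑-mono P (λ α → χ-guard (δ α ≈? v) (common≤R α)) ⟩
          (∑[ α ∈ P ] χ (δ α ≈? v) * R v)                    ≡⟨ ∑-*ʳ P _ (R v) ⟨
          r v * R v                                          ∎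
          where
          open ≤-Reasoning
          common≤R : ∀ α → δ α ≈ v → ∑ is (common α) ≤ R v
          common≤R (a , a′) δα≈v = begin
            (∑[ y ∈ is ] adj a y * adj a′ y)                                   ≡⟨ ∑-cong is (common-∑ a a′) ⟩
            (∑[ y ∈ is ] ∑[ ζ ∈ P ] τ a y (proj₁ ζ) * τ a′ y (proj₂ ζ))        ≡⟨ ∑-swap is P _ ⟩
            (∑[ ζ ∈ P ] ∑[ y ∈ is ] τ a y (proj₁ ζ) * τ a′ y (proj₂ ζ))        ≤⟨ ∑-mono P fibre ⟩
            R v                                                                ∎
            where
            fibre : ∀ ζ → (∑[ y ∈ is ] τ a y (proj₁ ζ) * τ a′ y (proj₂ ζ)) ≤ χ ((H (proj₂ ζ) - H (proj₁ ζ)) ≈? v)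
            fibre (z , z′) = begin
              (∑[ y ∈ is ] τ a y z * τ a′ y z′)                     ≤⟨ ∑-mono is (λ y → χ-guard ((F a ∙ G y ∙ H z) ≈? ε) λ h →
                χ-mono ((F a′ ∙ G y ∙ H z′) ≈? ε) hit λ h′ → ≈-trans (≈-sym (zeroSum⇒difference h h′)) δα≈v) ⟩
              (∑[ y ∈ is ] τ a y z * χ hit)                         ≡⟨ ∑-*ʳ is _ (χ hit) ⟨
              (∑[ y ∈ is ] τ a y z) * χ hit                         ≤⟨ *-monoˡ-≤ (χ hit) (τ-unique-y a z) ⟩
              1 * χ hit                                             ≡⟨ *-identityˡ (χ hit) ⟩
              χ hit                                                 ∎
              where hit = (H z′ - H z) ≈? v

        R≤M : ∀ v → R v ≤ M
        R≤M v = begin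
          R v                                                  ≡⟨ ∑-cartesian is is _ ⟩
          (∑[ z ∈ is ] ∑[ z′ ∈ is ] χ ((H z′ - H z) ≈? v))     ≤⟨ ∑-bound is (λ z → ≤-trans
            (∑-mono is λ z′ → χ-mono _ (H z′ ≈? (v ∙ H z)) λ h →
              ≈-trans (≈-sym (//-rightDividesˡ (H z) (H z′))) (∙-congʳ h)) (H-inj _)) ⟩
          M * 1                                                ≡⟨ *-identityʳ M ⟩
          M                                                    ∎
          where open ≤-Reasoning

        ∑vs-χ≤ : (f : I × I → Carrier) → (∑[ v ∈ vs ] ∑[ α ∈ P ] χ (f α ≈? v)) ≤ M * M
        ∑vs-χ≤ f = begin
          (∑[ v ∈ vs ] ∑[ α ∈ P ] χ (f α ≈? v))   ≡⟨ ∑-swap vs P _ ⟩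
          (∑[ α ∈ P ] ∑[ v ∈ vs ] χ (f α ≈? v))   ≤⟨ ∑-bound P (λ α → vs-unique (f α)) ⟩
          length P * 1                            ≡⟨ trans (*-identityʳ _) |P| ⟩
          M * M                                   ∎
          where open ≤-Reasoning

        paths≤∑ρ : paths ≤ ∑ vs ρ
        paths≤∑ρ = begin
          (∑[ α ∈ P ] ∑ is (common α))                                      ≤⟨ ∑-mono P (λ α → ≤-trans
            (≤-reflexive (sym (*-identityˡ _))) (*-monoˡ-≤ (∑ is (common α)) (vs-covers α))) ⟩
          (∑[ α ∈ P ] (∑[ v ∈ vs ] χ (δ α ≈? v)) * ∑ is (common α))         ≡⟨ ∑-cong P (λ α → ∑-*ʳ vs _ _) ⟩
          (∑[ α ∈ P ] ∑[ v ∈ vs ] χ (δ α ≈? v) * ∑ is (common α))           ≡⟨ ∑-swap P vs _ ⟩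
          (∑[ v ∈ vs ] ∑[ α ∈ P ] χ (δ α ≈? v) * ∑ is (common α))           ≡⟨ ∑-cong vs ρ-alt ⟨
          ∑ vs ρ                                                            ∎
          where open ≤-Reasoning

        parallelPaths : ℕ
        parallelPaths = ∑[ v ∈ vs ] ∑[ y ∈ is ] n v y * n v y

        ∑ρ²≤ : (∑[ v ∈ vs ] ρ v * ρ v) ≤ parallelPaths * M
        ∑ρ²≤ = begin
          (∑[ v ∈ vs ] ρ v * ρ v)                               ≤⟨ ∑-mono vs (λ v → power-mean is (n v)) ⟩
          (∑[ v ∈ vs ] (∑[ y ∈ is ] n v y * n v y) * M)         ≡⟨ ∑-*ʳ vs _ M ⟨
          parallelPaths * M                                     ∎
          where open ≤-Reasoning

        -- The M² pairs might all have distinct differences, which would leave too few paths for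
        -- each difference; ρ ≤ r R excludes this. It gives ρ² ≤ (ρ R) r, hence a bound of `paths`
        -- through ∑ ρ R, and a second Cauchy-Schwarz separates ∑ ρ² from ∑ R² ≤ M³.
        paths⁴≤ : (paths * paths) * (paths * paths) ≤ parallelPaths * M ^ 8
        paths⁴≤ = begin
          (paths * paths) * (paths * paths)             ≤⟨ *-mono-≤ paths²≤ paths²≤ ⟩
          (S * (M * M)) * (S * (M * M))                 ≡⟨ regroup₁ S M ⟩
          (S * S) * (M * M * (M * M))                   ≤⟨ *-monoˡ-≤ (M * M * (M * M)) S²≤ ⟩
          (parallelPaths * M * (M * (M * M))) * (M * M * (M * M))   ≡⟨ regroup₂ parallelPaths M ⟩
          parallelPaths * M ^ 8                         ∎
          where
          open ≤-Reasoning
          S = ∑[ v ∈ vs ] ρ v * R v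
          regroup₁ : ∀ S M → (S * (M * M)) * (S * (M * M)) ≡ (S * S) * (M * M * (M * M))
          regroup₁ = solve-∀
          regroup₂ : ∀ T M → (T * M * (M * (M * M))) * (M * M * (M * M)) ≡ T * (M * (M * (M * (M * (M * (M * (M * (M * 1))))))))
          regroup₂ = solve-∀
          regroup₃ : ∀ ρ r R → ρ * (r * R) ≡ (ρ * R) * r
          regroup₃ = solve-∀
          regroup₄ : ∀ ρ R → (ρ * R) * (ρ * R) ≡ (ρ * ρ) * (R * R)
          regroup₄ = solve-∀
          paths²≤ : paths * paths ≤ S * (M * M)
          paths²≤ = begin
            paths * paths          ≤⟨ *-mono-≤ paths≤∑ρ paths≤∑ρ ⟩
            ∑ vs ρ * ∑ vs ρ        ≤⟨ cauchy-schwarz vs (λ v → ≤-trans (*-monoʳ-≤ (ρ v) (ρ≤r*R v)) (≤-reflexive (regroup₃ (ρ v) (r v) (R v)))) ⟩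
            S * ∑ vs r             ≤⟨ *-monoʳ-≤ S (∑vs-χ≤ δ) ⟩
            S * (M * M)            ∎
          ∑R²≤ : (∑[ v ∈ vs ] R v * R v) ≤ M * (M * M)
          ∑R²≤ = begin
            (∑[ v ∈ vs ] R v * R v)    ≤⟨ ∑-mono vs (λ v → *-monoˡ-≤ (R v) (R≤M v)) ⟩
            (∑[ v ∈ vs ] M * R v)      ≡⟨ ∑-*ˡ M vs R ⟨
            M * ∑ vs R                 ≤⟨ *-monoʳ-≤ M (∑vs-χ≤ λ ζ → H (proj₂ ζ) - H (proj₁ ζ)) ⟩
            M * (M * M)                ∎
          S²≤ : S * S ≤ parallelPaths * M * (M * (M * M))
          S²≤ = begin
            S * S                                                    ≤⟨ cauchy-schwarz vs (λ v → ≤-reflexive (regroup₄ (ρ v) (R v))) ⟩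
            (∑[ v ∈ vs ] ρ v * ρ v) * (∑[ v ∈ vs ] R v * R v)        ≤⟨ *-mono-≤ ∑ρ²≤ ∑R²≤ ⟩
            parallelPaths * M * (M * (M * M))                        ∎

        E : I × I → Carrier → I → ℕ
        E α v y = χ (δ α ≈? v) * common α y

        -- Joins two pairs with equal differences through every y adjacent to all four entries. The
        -- total weight of this kernel is `parallelPaths`.
        K : I × I → I × I → ℕ
        K α β = ∑[ v ∈ vs ] ∑[ y ∈ is ] E α v y * E β v y

        K-sym : ∀ α β → K α β ≡ K β α
        K-sym α β = ∑-cong vs λ v → ∑-cong is λ y → *-comm (E α v y) (E β v y)

        open Walks P K K-sym

        walks-1 : walks 1 ≡ parallelPaths
        walks-1 = begin
          (∑[ α ∈ P ] ∑[ β ∈ P ] K α β * 1)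
            ≡⟨ ∑-cong P (λ α → trans (∑-cong P λ β → *-identityʳ (K α β)) (∑-swap P vs _)) ⟩
          (∑[ α ∈ P ] ∑[ v ∈ vs ] ∑[ β ∈ P ] ∑[ y ∈ is ] E α v y * E β v y)
            ≡⟨ ∑-cong P (λ α → ∑-cong vs λ v → trans (∑-swap P is _) (∑-cong is λ y → sym (∑-*ˡ (E α v y) P _))) ⟩
          (∑[ α ∈ P ] ∑[ v ∈ vs ] ∑[ y ∈ is ] E α v y * n v y)
            ≡⟨ trans (∑-swap P vs _) (∑-cong vs λ v → ∑-swap P is _) ⟩
          (∑[ v ∈ vs ] ∑[ y ∈ is ] ∑[ α ∈ P ] E α v y * n v y)
            ≡⟨ ∑-cong vs (λ v → ∑-cong is λ y → ∑-*ʳ P _ (n v y)) ⟨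
          parallelPaths  ∎
          where open ≡-Reasoning

        adj≤1 : ∀ x y → adj x y ≤ 1
        adj≤1 = τ-unique-z

        -- A chain uses only the edges a - y and y - b′ of the four at y; the other two are in `K`
        -- to make it symmetric, as `Walks` requires.
        K≤ : ∀ α β → K α β ≤ (∑[ y ∈ is ] χ (δ α ≈? δ β) * (adj (proj₁ α) y * adj (proj₂ β) y))
        K≤ α@(a , a′) β@(b , b′) = begin
          K α β                                                             ≤⟨ ∑-mono vs (λ v → ∑-mono is (term v)) ⟩
          (∑[ v ∈ vs ] ∑[ y ∈ is ] χ (δ α ≈? v) * X y)                      ≡⟨ ∑-swap vs is _ ⟩
          (∑[ y ∈ is ] ∑[ v ∈ vs ] χ (δ α ≈? v) * X y)                      ≡⟨ ∑-cong is (λ y → ∑-*ʳ vs _ (X y)) ⟨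
          (∑[ y ∈ is ] (∑[ v ∈ vs ] χ (δ α ≈? v)) * X y)                    ≤⟨ ∑-mono is (λ y → *-monoˡ-≤ (X y) (vs-unique (δ α))) ⟩
          (∑[ y ∈ is ] 1 * X y)                                             ≡⟨ ∑-cong is (λ y → *-identityˡ (X y)) ⟩
          ∑ is X                                                            ∎
          where
          open ≤-Reasoning
          X : I → ℕ
          X y = χ (δ α ≈? δ β) * (adj a y * adj b′ y)
          regroup : ∀ p q s t u w → (p * (s * t)) * (q * (u * w)) ≡ p * (q * ((s * w) * (t * u)))
          regroup = solve-∀
          term : ∀ v y → E α v y * E β v y ≤ χ (δ α ≈? v) * X y
          term v y = begin
            E α v y * E β v y
              ≡⟨ regroup (χ (δ α ≈? v)) (χ (δ β ≈? v)) (adj a y) (adj a′ y) (adj b y) (adj b′ y) ⟩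
            χ (δ α ≈? v) * (χ (δ β ≈? v) * ((adj a y * adj b′ y) * (adj a′ y * adj b y)))
              ≤⟨ χ-guard (δ α ≈? v) (λ p → *-mono-≤ (χ-mono (δ β ≈? v) (δ α ≈? δ β) (λ q → ≈-trans p (≈-sym q)))
                   (≤-trans (*-monoʳ-≤ (adj a y * adj b′ y) (*-mono-≤ (adj≤1 a′ y) (adj≤1 b y))) (≤-reflexive (*-identityʳ _)))) ⟩
            χ (δ α ≈? v) * X y  ∎

        -- At most M pairs β share the difference of α, and at most M vertices y join them to α.
        K-rows : ∀ α → (∑[ β ∈ P ] K α β) ≤ M * M
        K-rows α = begin
          (∑[ β ∈ P ] K α β)                                  ≤⟨ ∑-mono P (λ β → ≤-trans (K≤ α β) (∑-bound is λ y →
            ≤-trans (*-monoʳ-≤ (χ (δ α ≈? δ β)) (*-mono-≤ (adj≤1 (proj₁ α) y) (adj≤1 (proj₂ β) y))) (≤-reflexive (*-identityʳ _)))) ⟩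
          (∑[ β ∈ P ] M * χ (δ α ≈? δ β))                     ≡⟨ ∑-*ˡ M P _ ⟨
          M * (∑[ β ∈ P ] χ (δ α ≈? δ β))                     ≤⟨ *-monoʳ-≤ M (class-bound (δ α)) ⟩
          M * M                                               ∎
          where open ≤-Reasoning

        -- reps i v counts the ways to write - v as a sum of i differences H z - H z′.
        reps : ℕ → Carrier → ℕ
        reps zero    v = χ (v ≈? ε)
        reps (suc i) v = ∑[ ζ ∈ P ] reps i (v ∙ (H (proj₁ ζ) - H (proj₂ ζ)))

        reps-cong : ∀ i {v w} → v ≈ w → reps i v ≤ reps i w
        reps-cong zero    {v} {w} h = χ-mono (v ≈? ε) (w ≈? ε) (≈-trans (≈-sym h))
        reps-cong (suc i) h = ∑-mono P λ ζ → reps-cong i (∙-congʳ h)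

        -- Once the i pairs (z , z′) are fixed, the value of f b is fixed, and at most κ indices b
        -- attain it.
        ∑-reps : ∀ {b} {B : Set b} (bs : List B) {κ} i (f : B → Carrier) →
          (∀ v → (∑[ b ∈ bs ] χ (f b ≈? v)) ≤ κ) → (∑[ b ∈ bs ] reps i (f b)) ≤ κ * (M * M) ^ i
        ∑-reps bs {κ} zero    f mult = ≤-trans (mult ε) (≤-reflexive (sym (*-identityʳ κ)))
        ∑-reps bs {κ} (suc i) f mult = begin
          (∑[ b ∈ bs ] ∑[ ζ ∈ P ] reps i (f b ∙ w ζ))     ≡⟨ ∑-swap bs P _ ⟩
          (∑[ ζ ∈ P ] ∑[ b ∈ bs ] reps i (f b ∙ w ζ))     ≤⟨ ∑-bound P (λ ζ → ∑-reps bs i (λ b → f b ∙ w ζ) (shifted ζ)) ⟩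
          length P * (κ * (M * M) ^ i)                    ≡⟨ cong (_* (κ * (M * M) ^ i)) |P| ⟩
          M * M * (κ * (M * M) ^ i)                       ≡⟨ regroup (M * M) κ ((M * M) ^ i) ⟩
          κ * (M * M) ^ suc i                             ∎
          where
          open ≤-Reasoning
          w : I × I → Carrier
          w ζ = H (proj₁ ζ) - H (proj₂ ζ)
          shifted : ∀ ζ v → (∑[ b ∈ bs ] χ ((f b ∙ w ζ) ≈? v)) ≤ κ
          shifted ζ v = ≤-trans (∑-mono bs λ b → χ-mono _ (f b ≈? (v - w ζ))
            λ h → ≈-trans (≈-sym (//-rightDividesʳ (w ζ) (f b))) (∙-congʳ h)) (mult _)
          regroup : ∀ m κ x → m * (κ * x) ≡ κ * (m * x)
          regroup = solve-∀

        -- The balance F a + i v - F c of a chain with common difference v, where a and c are the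
        -- first entries of its first and last pair. A chain of i steps writes the negative of it as
        -- a sum of i differences of values of `H`.
        target : ℕ → I × I → I × I → Carrier
        target i α γ = F (proj₁ α) ∙ (i · δ α) - F (proj₁ γ)

        -- F b = F b′ + δ β trades b for b′ and one more copy of the common difference; the two zero
        -- sums through y then trade F b′ for F a.
        target-step : ∀ i α β γ {y z z′} → δ α ≈ δ β →
          F (proj₁ α) ∙ G y ∙ H z ≈ ε → F (proj₂ β) ∙ G y ∙ H z′ ≈ ε →
          target i β γ ≈ target (suc i) α γ ∙ (H z - H z′)
        target-step i α@(a , a′) β@(b , b′) γ@(c , _) {y} {z} {z′} δα≈δβ h h′ = begin
          (F b ∙ D) ∙ F c ⁻¹                                ≈⟨ ∙-congʳ (∙-cong (//-rightDividesˡ (F b′) (F b)) (·-congʳ i δα≈δβ)) ⟨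
          (δ β ∙ F b′ ∙ (i · δ α)) ∙ F c ⁻¹                 ≈⟨ ∙-congʳ (∙-congʳ (∙-congʳ δα≈δβ)) ⟨
          (δ α ∙ F b′ ∙ (i · δ α)) ∙ F c ⁻¹
            ≈⟨ ∙-congʳ (∙-congʳ (∙-congˡ (≈-trans (≈-sym (//-rightDividesˡ (F a) (F b′))) (comm (F b′ - F a) (F a))))) ⟩
          (δ α ∙ (F a ∙ (F b′ - F a)) ∙ (i · δ α)) ∙ F c ⁻¹
            ≈⟨ ∙-congʳ (∙-congʳ (∙-congˡ (∙-congˡ (zeroSum⇒difference h′ h)))) ⟩
          (δ α ∙ (F a ∙ (H z - H z′)) ∙ (i · δ α)) ∙ F c ⁻¹
            ≈⟨ CM.solve 5 (λ d a w e c → ((d ⊕ (a ⊕ w)) ⊕ e) ⊕ c ⊜ ((a ⊕ (d ⊕ e)) ⊕ c) ⊕ w) ≈-refl (δ α) (F a) (H z - H z′) (i · δ α) (F c ⁻¹) ⟩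
          target (suc i) α γ ∙ (H z - H z′)  ∎
          where
          open ≈-R
          D = i · δ β

        -- A step from α = (a , a′) through y to β = (b , b′) with δ α = δ β gives F a - F b′ = H z′ - H z,
        -- that is F a + δ α = F b + (H z′ - H z): every added copy of δ α costs one pair (z , z′).
        walk≤ : ∀ i α → walk i α ≤ (∑[ γ ∈ P ] χ (δ α ≈? δ γ) * reps i (target i α γ))
        walk≤ zero α@(a , _) = begin
          1                                                  ≡⟨ cong₂ _*_ (χ-yes (δ α ≈? δ α) ≈-refl) (χ-yes (target 0 α α ≈? ε) closed) ⟨
          χ (δ α ≈? δ α) * reps 0 (target 0 α α)             ≤⟨ ∑-∈ (λ γ → χ (δ α ≈? δ γ) * reps 0 (target 0 α γ)) (∈-P α) ⟩
          (∑[ γ ∈ P ] χ (δ α ≈? δ γ) * reps 0 (target 0 α γ)) ∎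
          where
          open ≤-Reasoning
          closed : F a ∙ ε - F a ≈ ε
          closed = ≈-trans (∙-congʳ (identityʳ (F a))) (inverseʳ (F a))
        walk≤ (suc i) α@(a , _) = begin
          (∑[ β ∈ P ] K α β * walk i β)                                  ≤⟨ ∑-mono P (λ β → *-monoʳ-≤ (K α β) (walk≤ i β)) ⟩
          (∑[ β ∈ P ] K α β * (∑[ γ ∈ P ] W β γ))                        ≡⟨ ∑-cong P (λ β → ∑-*ˡ (K α β) P (W β)) ⟩
          (∑[ β ∈ P ] ∑[ γ ∈ P ] K α β * W β γ)                          ≡⟨ ∑-swap P P _ ⟩
          (∑[ γ ∈ P ] ∑[ β ∈ P ] K α β * W β γ)                          ≤⟨ ∑-mono P step ⟩
          (∑[ γ ∈ P ] χ (δ α ≈? δ γ) * reps (suc i) (target (suc i) α γ)) ∎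
          where
          open ≤-Reasoning
          W : I × I → I × I → ℕ
          W β γ = χ (δ β ≈? δ γ) * reps i (target i β γ)

          T : I × I → I → I × I → ℕ
          T β y ζ = χ (δ α ≈? δ β) * (τ a y (proj₁ ζ) * τ (proj₂ β) y (proj₂ ζ))

          K≤T : ∀ β → K α β ≤ (∑[ y ∈ is ] ∑[ ζ ∈ P ] T β y ζ)
          K≤T β = ≤-trans (K≤ α β) (≤-reflexive (∑-cong is λ y →
            trans (cong (χ (δ α ≈? δ β) *_) (common-∑ a (proj₂ β) y)) (∑-*ˡ (χ (δ α ≈? δ β)) P _)))

          -- The pair (z , z′) determines the step: a and z give y, then y and z′ give b′, and b′
          -- with the common difference gives b.
          ∑T≤1 : ∀ ζ → (∑[ β ∈ P ] ∑[ y ∈ is ] T β y ζ) ≤ 1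
          ∑T≤1 (z , z′) = begin
            (∑[ β ∈ P ] ∑[ y ∈ is ] T β y (z , z′))           ≡⟨ ∑-swap P is _ ⟩
            (∑[ y ∈ is ] ∑[ β ∈ P ] T β y (z , z′))           ≡⟨ ∑-cong is (λ y → trans
              (∑-cong P λ β → move (χ (δ α ≈? δ β)) (τ a y z) (τ (proj₂ β) y z′)) (sym (∑-*ˡ (τ a y z) P _))) ⟩
            (∑[ y ∈ is ] τ a y z * (∑[ β ∈ P ] χ (δ α ≈? δ β) * τ (proj₂ β) y z′))
              ≤⟨ ∑-mono is (λ y → *-monoʳ-≤ (τ a y z) (unique-β y)) ⟩
            (∑[ y ∈ is ] τ a y z * 1)                         ≡⟨ ∑-cong is (λ y → *-identityʳ (τ a y z)) ⟩
            (∑[ y ∈ is ] τ a y z)                             ≤⟨ τ-unique-y a z ⟩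
            1                                                 ∎
            where
            move : ∀ c t t′ → c * (t * t′) ≡ t * (c * t′)
            move = solve-∀
            unique-β : ∀ y → (∑[ β ∈ P ] χ (δ α ≈? δ β) * τ (proj₂ β) y z′) ≤ 1
            unique-β y = begin
              (∑[ β ∈ P ] χ (δ α ≈? δ β) * τ (proj₂ β) y z′)                        ≡⟨ trans (∑-cartesian is is _) (∑-swap is is _) ⟩
              (∑[ b′ ∈ is ] ∑[ b ∈ is ] χ (δ α ≈? (F b - F b′)) * τ b′ y z′)        ≡⟨ ∑-cong is (λ b′ → ∑-*ʳ is _ (τ b′ y z′)) ⟨
              (∑[ b′ ∈ is ] (∑[ b ∈ is ] χ (δ α ≈? (F b - F b′))) * τ b′ y z′)      ≤⟨ ∑-mono is (λ b′ → *-monoˡ-≤ (τ b′ y z′) (minuend-unique (δ α) b′)) ⟩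
              (∑[ b′ ∈ is ] 1 * τ b′ y z′)                                          ≡⟨ ∑-cong is (λ b′ → *-identityˡ (τ b′ y z′)) ⟩
              (∑[ b′ ∈ is ] τ b′ y z′)                                              ≤⟨ τ-unique-x y z′ ⟩
              1                                                                     ∎

          step : ∀ γ → (∑[ β ∈ P ] K α β * W β γ) ≤ χ (δ α ≈? δ γ) * reps (suc i) (target (suc i) α γ)
          step γ = begin
            (∑[ β ∈ P ] K α β * W β γ)                                ≤⟨ ∑-mono P (λ β → *-monoˡ-≤ (W β γ) (K≤T β)) ⟩
            (∑[ β ∈ P ] (∑[ y ∈ is ] ∑[ ζ ∈ P ] T β y ζ) * W β γ)     ≡⟨ ∑-cong P (λ β → trans (∑-*ʳ is _ (W β γ)) (∑-cong is λ y → ∑-*ʳ P _ (W β γ))) ⟩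
            (∑[ β ∈ P ] ∑[ y ∈ is ] ∑[ ζ ∈ P ] T β y ζ * W β γ)       ≤⟨ ∑-mono P (λ β → ∑-mono is λ y → ∑-mono P (term β y)) ⟩
            (∑[ β ∈ P ] ∑[ y ∈ is ] ∑[ ζ ∈ P ] T β y ζ * Y ζ)         ≡⟨ trans (∑-cong P λ β → ∑-swap is P _) (∑-swap P P _) ⟩
            (∑[ ζ ∈ P ] ∑[ β ∈ P ] ∑[ y ∈ is ] T β y ζ * Y ζ)         ≡⟨ ∑-cong P (λ ζ → trans (∑-*ʳ P _ (Y ζ)) (∑-cong P λ β → ∑-*ʳ is _ (Y ζ))) ⟨
            (∑[ ζ ∈ P ] (∑[ β ∈ P ] ∑[ y ∈ is ] T β y ζ) * Y ζ)       ≤⟨ ∑-mono P (λ ζ → *-monoˡ-≤ (Y ζ) (∑T≤1 ζ)) ⟩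
            (∑[ ζ ∈ P ] 1 * Y ζ)                                      ≡⟨ ∑-cong P (λ ζ → *-identityˡ (Y ζ)) ⟩
            ∑ P Y                                                     ≡⟨ ∑-*ˡ (χ (δ α ≈? δ γ)) P _ ⟨
            χ (δ α ≈? δ γ) * reps (suc i) (target (suc i) α γ)        ∎
            where
            Y : I × I → ℕ
            Y ζ = χ (δ α ≈? δ γ) * reps i (target (suc i) α γ ∙ (H (proj₁ ζ) - H (proj₂ ζ)))
            assoc₃ : ∀ c t t′ w → c * (t * t′) * w ≡ c * (t * (t′ * w))
            assoc₃ = solve-∀
            term : ∀ β y ζ → T β y ζ * W β γ ≤ T β y ζ * Y ζ
            term β@(b , b′) y ζ@(z , z′) = begin
              T β y ζ * W β γ                                             ≡⟨ assoc₃ (χ (δ α ≈? δ β)) (τ a y z) (τ b′ y z′) (W β γ) ⟩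
              χ (δ α ≈? δ β) * (τ a y z * (τ b′ y z′ * W β γ))
                ≤⟨ χ-guard (δ α ≈? δ β) (λ δα≈δβ → χ-guard ((F a ∙ G y ∙ H z) ≈? ε) λ h → χ-guard ((F b′ ∙ G y ∙ H z′) ≈? ε) λ h′ →
                     *-mono-≤ (χ-mono (δ β ≈? δ γ) (δ α ≈? δ γ) (≈-trans δα≈δβ))
                       (reps-cong i (target-step i α β γ δα≈δβ h h′))) ⟩
              χ (δ α ≈? δ β) * (τ a y z * (τ b′ y z′ * Y ζ))              ≡⟨ assoc₃ (χ (δ α ≈? δ β)) (τ a y z) (τ b′ y z′) (Y ζ) ⟨
              T β y ζ * Y ζ                                               ∎

      -- In `mult` the pair p consists of the first entry of the first pair of a chain and the
      -- second entry c′ of its last pair (c , c′). The common difference is read off at the end of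
      -- the chain, as F c - F c′.
      module _ (m κ : ℕ)
        (mult : ∀ c v → (∑[ p ∈ cartesianProduct is is ] χ ((F (proj₁ p) ∙ (m · (F c - F (proj₂ p))) - F c) ≈? v)) ≤ κ)
        where

        private
          -- The difference of the last pair γ replaces that of the first pair α, after which the
          -- second entry of α is determined by the first. What remains is, for each c, a sum of
          -- `reps` to which `mult` applies.
          walks≤ : walks m ≤ κ * (M * M) ^ m * M
          walks≤ = begin
            walks m                                                                    ≤⟨ ∑-mono P (walk≤ m) ⟩
            (∑[ α ∈ P ] ∑[ γ ∈ P ] χ (δ α ≈? δ γ) * reps m (target m α γ))             ≤⟨ ∑-mono P (λ α → ∑-mono P (transport α)) ⟩
            (∑[ α ∈ P ] ∑[ γ ∈ P ] χ (δ α ≈? δ γ) * X (proj₁ α) γ)                     ≡⟨ trans (∑-swap P P _) (∑-cong P λ γ → ∑-cartesian is is _) ⟩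
            (∑[ γ ∈ P ] ∑[ a ∈ is ] ∑[ a′ ∈ is ] χ (δ (a , a′) ≈? δ γ) * X a γ)        ≡⟨ ∑-cong P (λ γ → ∑-cong is λ a → ∑-*ʳ is _ (X a γ)) ⟨
            (∑[ γ ∈ P ] ∑[ a ∈ is ] (∑[ a′ ∈ is ] χ (δ (a , a′) ≈? δ γ)) * X a γ)      ≤⟨ ∑-mono P (λ γ → ∑-mono is λ a →
              ≤-trans (*-monoˡ-≤ (X a γ) (subtrahend-unique a (δ γ))) (≤-reflexive (*-identityˡ (X a γ)))) ⟩
            (∑[ γ ∈ P ] ∑[ a ∈ is ] X a γ)                                             ≡⟨ ∑-cartesian is is _ ⟩
            (∑[ c ∈ is ] ∑[ c′ ∈ is ] ∑[ a ∈ is ] X a (c , c′))                        ≡⟨ ∑-cong is (λ c → trans (∑-swap is is _) (sym (∑-cartesian is is _))) ⟩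
            (∑[ c ∈ is ] ∑[ p ∈ P ] X (proj₁ p) (c , proj₂ p))                         ≤⟨ ∑-bound is (λ c → ∑-reps P m _ (mult c)) ⟩
            M * (κ * (M * M) ^ m)                                                      ≡⟨ *-comm M _ ⟩
            κ * (M * M) ^ m * M                                                        ∎
            where
            open ≤-Reasoning
            X : I → I × I → ℕ
            X a γ = reps m (F a ∙ (m · δ γ) - F (proj₁ γ))
            transport : ∀ α γ → χ (δ α ≈? δ γ) * reps m (target m α γ) ≤ χ (δ α ≈? δ γ) * X (proj₁ α) γ
            transport α γ = χ-guard (δ α ≈? δ γ) λ h → reps-cong m (∙-congʳ (∙-congˡ (·-congʳ m h)))
            subtrahend-unique : ∀ a v → (∑[ a′ ∈ is ] χ ((F a - F a′) ≈? v)) ≤ 1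
            subtrahend-unique a v = ≤-trans (∑-mono is λ a′ → χ-mono _ (F a′ ≈? (v ⁻¹ ∙ F a)) (λ h → begin′
              F a′                        ≈⟨ ≈-sym (//-rightDividesˡ (F a) (F a′)) ⟩
              (F a′ - F a) ∙ F a          ≈⟨ ∙-congʳ (⁻¹-anti-homo‿- (F a) (F a′)) ⟨
              (F a - F a′) ⁻¹ ∙ F a       ≈⟨ ∙-congʳ (⁻¹-cong h) ⟩
              v ⁻¹ ∙ F a                  ∎′)) (F-inj _)
              where open ≈-R renaming (begin_ to begin′_; _∎ to _∎′)

        -- For ε = `zeroSums` / M² this says ε ^ (8 · 2 ^ m) ≤ κ / M. The 8 comes from the three
        -- squarings that lead to `parallelPaths`, the 2 ^ m from the length of the walks.
        zeroSums-bound : M * zeroSums ^ (8 * 2 ^ m) ≤ κ * M ^ (16 * 2 ^ m)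
        zeroSums-bound = combine M refl
          where
          open ≤-Reasoning
          J = 2 ^ m
          -- The surplus steps removed by `walks-growth`; the subtraction is exact since m < 2 ^ m.
          l = J ∸ m
          s = zeroSums
          T = parallelPaths

          l+m≡J : l + m ≡ J
          l+m≡J = m∸n+n≡m (<⇒≤ (n<2^n m))

          s⁸≤ : s ^ 8 ≤ T * M ^ 12
          s⁸≤ = begin
            s ^ 8                                                       ≡⟨ r₁ s ⟩
            ((s * s) * (s * s)) * ((s * s) * (s * s))                   ≤⟨ *-mono-≤ (*-mono-≤ zeroSums²≤ zeroSums²≤) (*-mono-≤ zeroSums²≤ zeroSums²≤) ⟩
            ((p * M) * (p * M)) * ((p * M) * (p * M))                   ≡⟨ r₂ p M ⟩
            ((p * p) * (p * p)) * M ^ 4                                 ≤⟨ *-monoˡ-≤ (M ^ 4) paths⁴≤ ⟩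
            (T * M ^ 8) * M ^ 4                                         ≡⟨ *-assoc T (M ^ 8) (M ^ 4) ⟩
            T * (M ^ 8 * M ^ 4)                                         ≡⟨ cong (T *_) (^-distribˡ-+-* M 8 4) ⟨
            T * M ^ 12                                                  ∎
            where
            p = paths
            r₁ : ∀ s → s * (s * (s * (s * (s * (s * (s * (s * 1))))))) ≡ ((s * s) * (s * s)) * ((s * s) * (s * s))
            r₁ = solve-∀
            r₂ : ∀ p M → ((p * M) * (p * M)) * ((p * M) * (p * M)) ≡ ((p * p) * (p * p)) * (M * (M * (M * (M * 1))))
            r₂ = solve-∀

          M²T^J≤ : M * M * T ^ J ≤ κ * M * ((M * M) ^ J * (M * M) ^ J)
          M²T^J≤ = begin
            M * M * T ^ J                                         ≡⟨ cong₂ (λ n w → n * w ^ J) (sym |P|) (sym walks-1) ⟩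
            length P * walks 1 ^ J                                ≤⟨ walks-power m ⟩
            length P ^ J * walks J                                ≡⟨ cong (λ n → n ^ J * walks J) |P| ⟩
            (M * M) ^ J * walks J                                 ≡⟨ cong (λ j → (M * M) ^ J * walks j) l+m≡J ⟨
            (M * M) ^ J * walks (l + m)                           ≤⟨ *-monoʳ-≤ ((M * M) ^ J) (walks-growth K-rows l m) ⟩
            (M * M) ^ J * ((M * M) ^ l * walks m)                 ≤⟨ *-monoʳ-≤ ((M * M) ^ J) (*-monoʳ-≤ ((M * M) ^ l) walks≤) ⟩
            (M * M) ^ J * ((M * M) ^ l * (κ * (M * M) ^ m * M))   ≡⟨ regroup ((M * M) ^ J) ((M * M) ^ l) κ ((M * M) ^ m) M ⟩
            κ * M * ((M * M) ^ J * ((M * M) ^ l * (M * M) ^ m))   ≡⟨ cong (λ w → κ * M * ((M * M) ^ J * w)) (^-distribˡ-+-* (M * M) l m) ⟨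
            κ * M * ((M * M) ^ J * (M * M) ^ (l + m))             ≡⟨ cong (λ j → κ * M * ((M * M) ^ J * (M * M) ^ j)) l+m≡J ⟩
            κ * M * ((M * M) ^ J * (M * M) ^ J)                   ∎
            where
            regroup : ∀ a b k c M → a * (b * (k * c * M)) ≡ k * M * (a * (b * c))
            regroup = solve-∀

          M²^J : (M * M) ^ J * (M * M) ^ J ≡ M ^ (4 * J)
          M²^J = begin-equality
            (M * M) ^ J * (M * M) ^ J     ≡⟨ ^-distribʳ-* J (M * M) (M * M) ⟨
            (M * M * (M * M)) ^ J         ≡⟨ cong (_^ J) (fourth M) ⟩
            (M ^ 4) ^ J                   ≡⟨ ^-*-assoc M 4 J ⟩
            M ^ (4 * J)                   ∎
            where
            fourth : ∀ M → M * M * (M * M) ≡ M * (M * (M * (M * 1)))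
            fourth = solve-∀

          combine : ∀ k → M ≡ k → M * s ^ (8 * J) ≤ κ * M ^ (16 * J)
          combine zero    M≡0 = subst (λ M′ → M′ * s ^ (8 * J) ≤ κ * M ^ (16 * J)) (sym M≡0) z≤n
          combine (suc _) M≡  = *-cancelˡ-≤ M {{subst NonZero (sym M≡) _}} (begin
            M * (M * s ^ (8 * J))                   ≡⟨ *-assoc M M _ ⟨
            M * M * s ^ (8 * J)                     ≡⟨ cong (M * M *_) (^-*-assoc s 8 J) ⟨
            M * M * (s ^ 8) ^ J                     ≤⟨ *-monoʳ-≤ (M * M) (^-monoˡ-≤ J s⁸≤) ⟩
            M * M * (T * M ^ 12) ^ J                ≡⟨ cong (M * M *_) (^-distribʳ-* J T (M ^ 12)) ⟩
            M * M * (T ^ J * (M ^ 12) ^ J)          ≡⟨ *-assoc (M * M) (T ^ J) _ ⟨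
            M * M * T ^ J * (M ^ 12) ^ J            ≤⟨ *-monoˡ-≤ ((M ^ 12) ^ J) M²T^J≤ ⟩
            κ * M * ((M * M) ^ J * (M * M) ^ J) * (M ^ 12) ^ J
              ≡⟨ cong₂ (λ x y → κ * M * x * y) M²^J (^-*-assoc M 12 J) ⟩
            κ * M * M ^ (4 * J) * M ^ (12 * J)      ≡⟨ regroup κ M (M ^ (4 * J)) (M ^ (12 * J)) ⟩
            M * (κ * (M ^ (4 * J) * M ^ (12 * J)))  ≡⟨ cong (λ x → M * (κ * x)) (^-distribˡ-+-* M (4 * J) (12 * J)) ⟨
            M * (κ * M ^ (4 * J + 12 * J))          ≡⟨ cong (λ x → M * (κ * M ^ x)) (*-distribʳ-+ J 4 12) ⟨
            M * (κ * M ^ (16 * J))                  ∎)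
            where
            regroup : ∀ k M a b → k * M * a * b ≡ M * (k * (a * b))
            regroup = solve-∀

open AdditiveCombinatorics

-- Lifting an additive map modulo N to an additive map modulo qN.

module Lifts where

  open import Level using (Level) renaming (suc to lsuc)
  open import Algebra.Bundles using (AbelianGroup; module AbelianGroup)
  open import Data.Nat as ℕ using (ℕ; zero; suc; _^_; _<_)
  import Data.Nat.Properties as ℕ
  open import Data.Nat.Divisibility using (divides) renaming (_∣_ to _∣ᵤ_; _∣?_ to _∣?ᵤ_)
  open import Data.Nat.Primality using (Prime; prime⇒irreducible; prime⇒nonZero)
  open import Data.Nat.Coprimality using (Coprime; coprime-Bézout)
  open import Data.Nat.GCD using (module Bézout)
  open import Data.Integer as ℤ using (ℤ; +_; -_; _+_; _-_; _*_; 0ℤ)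
  import Data.Integer.Properties as ℤ
  open import Data.Integer.Divisibility.Signed
  open import Data.Nat.Tactic.RingSolver using () renaming (solve-∀ to ℕ-solve-∀)
  open import Data.Integer.Tactic.RingSolver using (solve-∀)
  import Algebra.Properties.CommutativeMonoid.Mult as Mult
  import Algebra.Properties.AbelianGroup as AbelianGroupProperties
  import Algebra.Properties.CommutativeSemigroup as CommutativeSemigroupProperties
  open import Data.List using ([]; _∷_)
  open import Data.List.Membership.Propositional using (_∈_)
  open import Data.List.Relation.Unary.All as All using (All; []; _∷_)
  open import Data.Product using (_×_; _,_; proj₁; proj₂; ∃)
  open import Data.Sum using (inj₁; inj₂)
  open import Relation.Nullary using (yes; no; ¬_; contradiction)
  open import Relation.Nullary.Negation using (¬¬-map)
  open import Relation.Nullary.Decidable using (¬¬-excluded-middle)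
  open import Relation.Binary.PropositionalEquality using (_≡_; refl; sym; trans; cong; cong₂; subst; subst₂; module ≡-Reasoning)

  ∣-by : ∀ {d m n} → m ≡ n → d ∣ m → d ∣ n
  ∣-by refl d∣m = d∣m

  module _ {a : Level} (𝒜 : FiniteAbelianGroup a) where

    open FiniteAbelianGroup 𝒜
    open AbelianGroup abelianGroup using (identityˡ; identityʳ; inverseˡ; inverseʳ)
    open AbelianGroupProperties abelianGroup
    open CommutativeSemigroupProperties (AbelianGroup.commutativeSemigroup abelianGroup) using (interchange)
    open Mult (AbelianGroup.commutativeMonoid abelianGroup)
      using (×-homo-+; ×-assocˡ; ×-distrib-+) renaming (_×_ to _·_)

    module Additive (N : ℕ) (α : Carrier → ℤ) (α-additive : ∀ x y → + N ∣ α (x ⊕ y) - (α x + α y)) where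

      α-0 : + N ∣ α 0#
      α-0 = ∣-by (lemma (α 0#)) (∣m⇒∣-m (subst (λ z → + N ∣ α z - (α 0# + α 0#)) (identityˡ 0#) (α-additive 0# 0#)))
        where
        lemma : ∀ i → - (i - (i + i)) ≡ i
        lemma = solve-∀

      α-⊖ : ∀ x → + N ∣ α (⊖ x) + α x
      α-⊖ x = ∣-by (lemma (α 0#) (α (⊖ x)) (α x))
        (∣m∣n⇒∣m-n α-0 (subst (λ z → + N ∣ α z - (α (⊖ x) + α x)) (inverseˡ x) (α-additive (⊖ x) x)))
        where
        lemma : ∀ z m i → z - (z - (m + i)) ≡ m + i
        lemma = solve-∀

      α-· : ∀ n x → + N ∣ α (n · x) - + n * α x
      α-· zero    x = ∣-by (lemma (α 0#) (α x)) α-0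
        where
        lemma : ∀ z i → z ≡ z - + 0 * i
        lemma = solve-∀
      α-· (suc n) x = ∣-by
        (trans (lemma (α (x ⊕ n · x)) (α x) (α (n · x)) (+ n)) (cong (λ m → α (x ⊕ n · x) - m * α x) (sym (ℤ.pos-+ 1 n))))
        (∣m∣n⇒∣m+n (α-additive x (n · x)) (α-· n x))
        where
        lemma : ∀ s i m n → (s - (i + m)) + (m - n * i) ≡ s - (+ 1 + n) * i
        lemma = solve-∀

    -- `α-torsion` is also necessary for a lift: if q x = 0, then q times the lifted value vanishes
    -- modulo qN, so that the value itself, and with it α x, vanishes modulo N.
    module Lifting (p k N : ℕ) (p-prime : Prime p) (N>0 : 0 < N)
      (α : Carrier → ℤ) (α-additive : ∀ x y → + N ∣ α (x ⊕ y) - (α x + α y))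
      (α-torsion : ∀ x → (p ^ suc k) · x ≡ 0# → + N ∣ α x)
      where

      private
        q : ℕ
        q = p ^ suc k

      private instance
        p≢0 : ℕ.NonZero p
        p≢0 = prime⇒nonZero p-prime
        N≢0 : ℕ.NonZero N
        N≢0 = ℕ.>-nonZero N>0

      N∣qN : + N ∣ + (q ℕ.* N)
      N∣qN = ∣ᵤ⇒∣ (divides q refl)

      *q-∣ : ∀ {i} → + N ∣ i → + (q ℕ.* N) ∣ + q * i
      *q-∣ {i} h = subst (_∣ + q * i) (sym (ℤ.pos-* q N)) (*-monoʳ-∣ (+ q) h)

      open Additive N α α-additive

      -- The graph of a homomorphism into ℤ/qN, defined on a subgroup containing q𝒜, that lifts α.
      record PartialLift : Set (lsuc a) where
        field
          K      : Carrier → ℤ → Set a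
          K-+    : ∀ {x y w z} → K x w → K y z → K (x ⊕ y) (w + z)
          K-⊖    : ∀ {x w} → K x w → K (⊖ x) (- w)
          K-q·   : ∀ x → K (q · x) (+ q * α x)
          K-lift : ∀ {x w} → K x w → + N ∣ w - α x
          K-0    : ∀ {w} → K 0# w → + (q ℕ.* N) ∣ w

        Dom : Carrier → Set a
        Dom x = ∃ (K x)

        K-zero : K 0# 0ℤ
        K-zero = subst₂ K (inverseʳ (q · 0#)) (ℤ.+-inverseʳ (+ q * α 0#)) (K-+ (K-q· 0#) (K-⊖ (K-q· 0#)))

        K-· : ∀ n {x w} → K x w → K (n · x) (+ n * w)
        K-· zero    {w = w} h = subst (K 0#) (sym (ℤ.*-zeroˡ w)) K-zero
        K-· (suc n) {w = w} h = subst (K _) (trans (lemma (+ n) w) (cong (_* w) (sym (ℤ.pos-+ 1 n)))) (K-+ h (K-· n h))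
          where
          lemma : ∀ n w → w + n * w ≡ (+ 1 + n) * w
          lemma = solve-∀

        K-unique : ∀ {x w z} → K x w → K x z → + (q ℕ.* N) ∣ w - z
        K-unique {x} h h′ = K-0 (subst (λ y → K y _) (inverseʳ x) (K-+ h (K-⊖ h′)))

      open PartialLift using (Dom)

      -- On q𝒜 the lift is forced: a value at y known modulo N fixes q times it modulo qN.
      -- `α-torsion` makes q · y ↦ q α y well defined.
      base : PartialLift
      base = record
        { K      = λ x w → Σ[ y ∈ Carrier ] (q · y ≡ x × + (q ℕ.* N) ∣ w - + q * α y)
        ; K-+    = λ { {w = w} {z} (x , refl , h) (y , refl , h′) → x ⊕ y , ×-distrib-+ x y q ,
            ∣-by (lemma₁ w z (+ q) (α x) (α y) (α (x ⊕ y)))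
              (∣m∣n⇒∣m-n (∣m∣n⇒∣m+n h h′) (*q-∣ (α-additive x y))) }
        ; K-⊖    = λ { {w = w} (x , refl , h) → ⊖ x , q·⊖ x ,
            ∣-by (lemma₂ w (+ q) (α (⊖ x)) (α x)) (∣m⇒∣-m (∣m∣n⇒∣m+n h (*q-∣ (α-⊖ x)))) }
        ; K-q·   = λ x → x , refl , ∣-by (sym (ℤ.+-inverseʳ (+ q * α x))) (∣ᵤ⇒∣ (divides 0 refl))
        ; K-lift = λ { {w = w} (x , refl , h) →
            ∣-by (lemma₃ w (+ q * α x) (α (q · x))) (∣m∣n⇒∣m-n (∣-trans N∣qN h) (α-· q x)) }
        ; K-0    = λ { {w} (x , qx≡0 , h) →
            ∣-by (lemma₄ w (+ q * α x)) (∣m∣n⇒∣m+n h (*q-∣ (α-torsion x qx≡0))) }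
        }
        where
        q·⊖ : ∀ x → q · (⊖ x) ≡ ⊖ (q · x)
        q·⊖ x = inverseˡ-unique _ _ (trans (sym (×-distrib-+ (⊖ x) x q))
          (trans (cong (q ·_) (inverseˡ x)) (×-zero q)))
          where
          ×-zero : ∀ n → n · 0# ≡ 0#
          ×-zero zero    = refl
          ×-zero (suc n) = trans (identityˡ _) (×-zero n)
        lemma₁ : ∀ w z q i j s → ((w - q * i) + (z - q * j)) - q * (s - (i + j)) ≡ (w + z) - q * s
        lemma₁ = solve-∀
        lemma₂ : ∀ w q m i → - ((w - q * i) + q * (m + i)) ≡ - w - q * m
        lemma₂ = solve-∀
        lemma₃ : ∀ w c d → (w - c) - (d - c) ≡ w - d
        lemma₃ = solve-∀
        lemma₄ : ∀ w c → (w - c) + c ≡ w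
        lemma₄ = solve-∀

      infix 4 _⊆_
      _⊆_ : PartialLift → PartialLift → Set a
      L ⊆ L′ = ∀ {x} → Dom L x → Dom L′ x

      -- A value v at e has to satisfy p v = w₀ and agree with α e modulo N. Writing w₀ - p α e = u
      -- N, such a v exists as soon as p divides u.
      module Extension (L : PartialLift) (e : Carrier)
        (pe∈ : Dom L (p · e)) (e∉ : ¬ Dom L e) where

        open PartialLift L hiding (Dom)

        w₀ = proj₁ pe∈

        u : ∃ λ u → w₀ - + p * α e ≡ u * + N
        u with ∣-by (lemma w₀ (α (p · e)) (+ p * α e)) (∣m∣n⇒∣m+n (K-lift (proj₂ pe∈)) (α-· p e))
          where
          lemma : ∀ w c d → (w - c) + (c - d) ≡ w - d
          lemma = solve-∀
        ... | divides u eq = u , eq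

        -- The value at q · e can be computed in two ways, as p ^ k w₀ and as q α e, since q𝒜 lies
        -- in the domain. Their difference p ^ k N u is thus divisible by qN = p ^ k N p.
        p∣u : + p ∣ proj₁ u
        p∣u = *-cancelˡ-∣ (+ (p ^ k ℕ.* N)) {{ℕ.m*n≢0 (p ^ k) N {{ℕ.m^n≢0 p k}}}}
          (subst₂ _∣_ modulus value (K-unique (subst (λ x → K x _) p^k·pe (K-· (p ^ k) (proj₂ pe∈))) (K-q· e)))
          where
          p^k·pe : (p ^ k) · (p · e) ≡ q · e
          p^k·pe = trans (×-assocˡ e (p ^ k) p) (cong (_· e) (ℕ.*-comm (p ^ k) p))
          modulus : + (q ℕ.* N) ≡ + (p ^ k ℕ.* N) * + p
          modulus = trans (cong +_ (lemma p (p ^ k) N)) (ℤ.pos-* (p ^ k ℕ.* N) p)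
            where
            lemma : ∀ p m n → p ℕ.* m ℕ.* n ≡ m ℕ.* n ℕ.* p
            lemma = ℕ-solve-∀
          value : + (p ^ k) * w₀ - + q * α e ≡ + (p ^ k ℕ.* N) * proj₁ u
          value = begin
            + (p ^ k) * w₀ - + q * α e                   ≡⟨ cong (λ m → + (p ^ k) * w₀ - m * α e) (ℤ.pos-* p (p ^ k)) ⟩
            + (p ^ k) * w₀ - + p * + (p ^ k) * α e       ≡⟨ factor (+ (p ^ k)) w₀ (+ p) (α e) ⟩
            + (p ^ k) * (w₀ - + p * α e)                 ≡⟨ cong (+ (p ^ k) *_) (proj₂ u) ⟩
            + (p ^ k) * (proj₁ u * + N)                  ≡⟨ regroup (+ (p ^ k)) (proj₁ u) (+ N) ⟩
            + (p ^ k) * + N * proj₁ u                    ≡⟨ cong (_* proj₁ u) (ℤ.pos-* (p ^ k) N) ⟨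
            + (p ^ k ℕ.* N) * proj₁ u                    ∎
            where
            open ≡-Reasoning
            factor : ∀ m w p i → m * w - p * m * i ≡ m * (w - p * i)
            factor = solve-∀
            regroup : ∀ m u n → m * (u * n) ≡ m * n * u
            regroup = solve-∀

        v : ℤ
        v = α e + quotient p∣u * + N

        pv≡w₀ : + p * v ≡ w₀
        pv≡w₀ = begin
          + p * (α e + quotient p∣u * + N)          ≡⟨ expand (+ p) (α e) (quotient p∣u) (+ N) ⟩
          + p * α e + quotient p∣u * + p * + N      ≡⟨ cong (λ m → + p * α e + m * + N) (_∣_.equality p∣u) ⟨
          + p * α e + proj₁ u * + N                 ≡⟨ cong (λ m → + p * α e + m) (proj₂ u) ⟨
          + p * α e + (w₀ - + p * α e)              ≡⟨ cancel (+ p * α e) w₀ ⟩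
          w₀                                        ∎
          where
          open ≡-Reasoning
          expand : ∀ p i m n → p * (i + m * n) ≡ p * i + m * p * n
          expand = solve-∀
          cancel : ∀ i w → i + (w - i) ≡ w
          cancel = solve-∀

        K-pe : K (p · e) (+ p * v)
        K-pe = subst (K _) (sym pv≡w₀) (proj₂ pe∈)

        combination : ∀ y m x n → 1 ℕ.+ y ℕ.* m ≡ x ℕ.* n → Dom L (m · e) → Dom L (n · e) → Dom L e
        combination y m x n eq (_ , hm) (_ , hn) = _ , subst (λ z → K z _) (begin
          x · (n · e) ⊕ ⊖ (y · (m · e))             ≡⟨ cong₂ (λ s t → s ⊕ ⊖ t) (×-assocˡ e x n) (×-assocˡ e y m) ⟩
          (x ℕ.* n) · e ⊕ ⊖ ((y ℕ.* m) · e)         ≡⟨ cong (λ s → s · e ⊕ ⊖ ((y ℕ.* m) · e)) eq ⟨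
          (e ⊕ (y ℕ.* m) · e) ⊕ ⊖ ((y ℕ.* m) · e)   ≡⟨ //-rightDividesʳ ((y ℕ.* m) · e) e ⟩
          e                                         ∎) (K-+ (K-· x hn) (K-⊖ (K-· y hm)))
          where open ≡-Reasoning

        -- Otherwise Bézout writes e as a combination of j · e and p · e, and e would already be in
        -- the domain. This is where p has to be prime.
        ·e∈⇒p∣ : ∀ j → Dom L (j · e) → p ∣ᵤ j
        ·e∈⇒p∣ j je∈ with p ∣?ᵤ j
        ... | yes p∣j = p∣j
        ... | no  p∤j with coprime-Bézout coprime
          where
          coprime : Coprime p j
          coprime (d∣p , d∣j) with prime⇒irreducible p-prime d∣p
          ... | inj₁ d≡1  = d≡1
          ... | inj₂ refl = contradiction d∣j p∤j
        ...   | Bézout.+- x y eq = contradiction (combination y j x p eq je∈ pe∈) e∉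
        ...   | Bézout.-+ x y eq = contradiction (combination x p y j eq pe∈ je∈) e∉

        -- p - 1 copies of e stand in for - e, since K already contains (p · e , p v).
        extension : PartialLift
        extension = record
          { K      = λ x w → Σ[ j ∈ ℕ ] K (x ⊕ ⊖ (j · e)) (w - + j * v)
          ; K-+    = λ { {x} {y} {w} {z} (i , h) (j , h′) → i ℕ.+ j ,
              subst₂ K (add-arg x y i j) (add-val w z i j) (K-+ h h′) }
          ; K-⊖    = λ { {x} {w} (j , h) → ℕ.pred p ℕ.* j ,
              subst₂ K (neg-arg x j) (neg-val w j) (K-+ (K-⊖ h) (K-⊖ (K-· j K-pe))) }
          ; K-q·   = λ x → 0 , embed (K-q· x)
          ; K-lift = λ { {x} {w} (j , h) → ∣-by (lemma w (+ j) v (α x) (α e) (α (⊖ (j · e))) (α (j · e)) (α (x ⊕ ⊖ (j · e))))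
              (∣m∣n⇒∣m+n (∣m∣n⇒∣m+n (∣m∣n⇒∣m-n (∣m∣n⇒∣m+n (K-lift h)
                (α-additive x (⊖ (j · e)))) (α-· j e)) (α-⊖ (j · e))) (∣n⇒∣m*n (+ j) v≡αe)) }
          ; K-0    = K-0′
          }
          where
          embed : ∀ {x w} → K x w → K (x ⊕ ⊖ (0 · e)) (w - + 0 * v)
          embed {x} {w} = subst₂ K (sym (trans (cong (x ⊕_) ε⁻¹≈ε) (identityʳ x))) (lemma w v)
            where
            lemma : ∀ w v → w ≡ w - + 0 * v
            lemma = solve-∀
          v≡αe : + N ∣ v - α e
          v≡αe = divides (quotient p∣u) (lemma (α e) (quotient p∣u * + N))
            where
            lemma : ∀ i m → (i + m) - i ≡ m
            lemma = solve-∀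
          lemma : ∀ w j v i ε m n s →
            (((((w - j * v) - s) + (s - (i + m))) - (n - j * ε)) + (m + n)) + j * (v - ε) ≡ w - i
          lemma = solve-∀
          add-arg : ∀ x y i j → (x ⊕ ⊖ (i · e)) ⊕ (y ⊕ ⊖ (j · e)) ≡ (x ⊕ y) ⊕ ⊖ ((i ℕ.+ j) · e)
          add-arg x y i j = trans (interchange x (⊖ (i · e)) y (⊖ (j · e)))
            (cong (x ⊕ y ⊕_) (trans (⁻¹-∙-comm (i · e) (j · e)) (cong ⊖_ (sym (×-homo-+ e i j)))))
          add-val : ∀ w z i j → (w - + i * v) + (z - + j * v) ≡ (w + z) - + (i ℕ.+ j) * v
          add-val w z i j = trans (add-val′ w z (+ i) (+ j) v) (cong (λ m → (w + z) - m * v) (sym (ℤ.pos-+ i j)))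
            where
            add-val′ : ∀ w z i j v → (w - i * v) + (z - j * v) ≡ (w + z) - (i + j) * v
            add-val′ = solve-∀
          j·pe : ∀ j → j · (p · e) ≡ (ℕ.pred p ℕ.* j) · e ⊕ j · e
          j·pe j = begin
            j · (p · e)                            ≡⟨ ×-assocˡ e j p ⟩
            (j ℕ.* p) · e                          ≡⟨ cong (λ n → (j ℕ.* n) · e) (ℕ.suc-pred p) ⟨
            (j ℕ.* suc (ℕ.pred p)) · e             ≡⟨ cong (_· e) (arith j (ℕ.pred p)) ⟩
            (ℕ.pred p ℕ.* j ℕ.+ j) · e             ≡⟨ ×-homo-+ e (ℕ.pred p ℕ.* j) j ⟩
            (ℕ.pred p ℕ.* j) · e ⊕ j · e           ∎
            where
            open ≡-Reasoning
            arith : ∀ j m → j ℕ.* suc m ≡ m ℕ.* j ℕ.+ j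
            arith = ℕ-solve-∀
          neg-arg : ∀ x j → ⊖ (x ⊕ ⊖ (j · e)) ⊕ ⊖ (j · (p · e)) ≡ ⊖ x ⊕ ⊖ ((ℕ.pred p ℕ.* j) · e)
          neg-arg x j = begin
            ⊖ (x ⊕ ⊖ J) ⊕ ⊖ (j · (p · e))       ≡⟨ cong (λ y → ⊖ (x ⊕ ⊖ J) ⊕ ⊖ y) (j·pe j) ⟩
            ⊖ (x ⊕ ⊖ J) ⊕ ⊖ (Y ⊕ J)             ≡⟨ ⁻¹-∙-comm (x ⊕ ⊖ J) (Y ⊕ J) ⟩
            ⊖ ((x ⊕ ⊖ J) ⊕ (Y ⊕ J))             ≡⟨ cong ⊖_ (interchange x (⊖ J) Y J) ⟩
            ⊖ ((x ⊕ Y) ⊕ (⊖ J ⊕ J))             ≡⟨ cong (λ y → ⊖ ((x ⊕ Y) ⊕ y)) (inverseˡ J) ⟩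
            ⊖ ((x ⊕ Y) ⊕ 0#)                    ≡⟨ cong ⊖_ (identityʳ (x ⊕ Y)) ⟩
            ⊖ (x ⊕ Y)                           ≡⟨ ⁻¹-∙-comm x Y ⟨
            ⊖ x ⊕ ⊖ Y                           ∎
            where
            open ≡-Reasoning
            J = j · e
            Y = (ℕ.pred p ℕ.* j) · e
          neg-val : ∀ w j → - (w - + j * v) + - (+ j * (+ p * v)) ≡ - w - + (ℕ.pred p ℕ.* j) * v
          neg-val w j = begin
            - (w - + j * v) + - (+ j * (+ p * v))               ≡⟨ cong (λ m → - (w - + j * v) + - (+ j * (m * v))) p-split ⟩
            - (w - + j * v) + - (+ j * ((+ 1 + p′) * v))        ≡⟨ neg-val′ w (+ j) p′ v ⟩
            - w - p′ * + j * v                                  ≡⟨ cong (λ m → - w - m * v) (ℤ.pos-* (ℕ.pred p) j) ⟨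
            - w - + (ℕ.pred p ℕ.* j) * v                        ∎
            where
            open ≡-Reasoning
            p′ = + ℕ.pred p
            p-split : + p ≡ + 1 + p′
            p-split = trans (cong +_ (sym (ℕ.suc-pred p))) (ℤ.pos-+ 1 (ℕ.pred p))
            neg-val′ : ∀ w j p v → - (w - j * v) + - (j * ((+ 1 + p) * v)) ≡ - w - p * j * v
            neg-val′ = solve-∀
          -- A multiple j of (e , v) meets the old domain only if j = c p, and then it is c times (p
          -- · e , p v), which is already in the graph; so no new value at 0 arises.
          K-0′ : ∀ {w} → Σ[ j ∈ ℕ ] K (0# ⊕ ⊖ (j · e)) (w - + j * v) → + (q ℕ.* N) ∣ w
          K-0′ {w} (j , h) = from-multiple
            (·e∈⇒p∣ j (- (w - + j * v) , subst (λ x → K x (- (w - + j * v))) (trans (cong ⊖_ (identityˡ _)) (⁻¹-involutive (j · e))) (K-⊖ h)))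
            where
            from-multiple : p ∣ᵤ j → + (q ℕ.* N) ∣ w
            from-multiple (divides c j≡cp) = K-0 (subst₂ K arg val (K-+ h (K-· c K-pe)))
              where
              arg : 0# ⊕ ⊖ (j · e) ⊕ c · (p · e) ≡ 0#
              arg = trans (cong₂ _⊕_ (identityˡ _) (trans (×-assocˡ e c p) (cong (_· e) (sym j≡cp)))) (inverseˡ (j · e))
              val : w - + j * v + + c * (+ p * v) ≡ w
              val = trans (cong (λ m → w - m * v + + c * (+ p * v)) (trans (cong +_ j≡cp) (ℤ.pos-* c p))) (val′ w (+ c) (+ p) v)
                where
                val′ : ∀ w c p v → w - c * p * v + c * (p * v) ≡ w
                val′ = solve-∀

        ⊆-extension : L ⊆ extension
        ⊆-extension {x} (w , h) = w , 0 , subst₂ K (sym (trans (cong (x ⊕_) ε⁻¹≈ε) (identityʳ x))) (lemma w v) h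
          where
          lemma : ∀ w v → w ≡ w - + 0 * v
          lemma = solve-∀

        e∈extension : Dom extension e
        e∈extension = v , 1 , subst₂ K (sym (trans (cong (λ x → e ⊕ ⊖ x) (identityʳ e)) (inverseʳ e))) (lemma v) K-zero
          where
          lemma : ∀ v → 0ℤ ≡ v - + 1 * v
          lemma = solve-∀

      -- Descends from p ^ i · g to g, one factor p at a time. Membership in the domain of a
      -- relation is not decidable, hence the double negation.
      adjoin : ∀ i L g → Dom L ((p ^ i) · g) → ¬ ¬ (Σ[ L′ ∈ PartialLift ] (L ⊆ L′ × Dom L′ g))
      adjoin zero    L g g∈ ¬ext = ¬ext (L , (λ x∈ → x∈) , subst (Dom L) (identityʳ g) g∈)
      adjoin (suc i) L g pe∈ ¬ext = ¬¬-excluded-middle λ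
        { (yes e∈) → adjoin i L g e∈ ¬ext
        ; (no e∉)  → let open Extension L ((p ^ i) · g) (subst (Dom L) (sym (×-assocˡ g p (p ^ i))) pe∈) e∉ in
            adjoin i extension g e∈extension
              (λ { (L′ , ⊆′ , g∈) → ¬ext (L′ , (λ x∈ → ⊆′ (⊆-extension x∈)) , g∈) })
        }

      adjoin-all : ∀ xs → ¬ ¬ (Σ[ L ∈ PartialLift ] All (Dom L) xs)
      adjoin-all []       ¬ext = ¬ext (base , [])
      adjoin-all (x ∷ xs) ¬ext = adjoin-all xs λ { (L , xs∈) →
        -- q · x is in the domain of every partial lift, so the descent can start at exponent suc k.
        adjoin (suc k) L x (_ , PartialLift.K-q· L x) λ { (L′ , L⊆L′ , x∈) →
          ¬ext (L′ , x∈ ∷ All.map L⊆L′ xs∈) } }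

      lift : ¬ ¬ (Σ[ λ′ ∈ (Carrier → ℤ) ]
        ((∀ x y → + (q ℕ.* N) ∣ λ′ (x ⊕ y) - (λ′ x + λ′ y)) × (∀ x → + N ∣ λ′ x - α x)))
      lift = ¬¬-map total (adjoin-all elements)
        where
        total : (Σ[ L ∈ PartialLift ] All (Dom L) elements) → _
        total (L , all∈) = (λ x → proj₁ (dom x)) ,
          (λ x y → K-unique (proj₂ (dom (x ⊕ y))) (K-+ (proj₂ (dom x)) (proj₂ (dom y)))) ,
          (λ x → K-lift (proj₂ (dom x)))
          where
          open PartialLift L hiding (Dom)
          dom : ∀ x → Dom L x
          dom x = All.lookup all∈ (∈-elements x)

open Lifts

-- From a solution modulo qN to an additive map modulo N, and the torsion element e.

module Solutions where

  open import Level using (Level)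
  open import Algebra.Bundles using (AbelianGroup; module AbelianGroup)
  open import Data.Fin using (Fin; toℕ; fromℕ<)
  open import Data.Fin.Properties using (toℕ-fromℕ<)
  open import Data.Nat as ℕ using (ℕ; suc; _^_; _<_; NonZero)
  import Data.Nat.Properties as ℕ
  open import Data.Nat.Divisibility using (divides) renaming (_∣_ to _∣ᵤ_)
  open import Data.Nat.Primality using (Prime; prime⇒nonZero)
  open import Data.Integer as ℤ using (ℤ; +_; -_; _+_; _-_; _*_)
  import Data.Integer.Properties as ℤ
  open import Data.Integer.DivMod using (_%ℕ_; _/ℕ_; n%ℕd<d; a≡a%ℕn+[a/ℕn]*n)
  open import Data.Integer.Divisibility.Signed
  open import Data.Integer.Tactic.RingSolver using (solve-∀)
  import Algebra.Properties.CommutativeMonoid.Mult as Mult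
  open import Data.List.Membership.Propositional using (lose)
  open import Data.List.Relation.Unary.Any as Any using (satisfied)
  open import Data.Product using (_×_; _,_; proj₁; proj₂; ∃)
  open import Data.Sum using (inj₁; inj₂)
  open import Relation.Nullary using (yes; no; ¬_; contradiction; ¬?)
  open import Relation.Nullary.Decidable using (_×-dec_; decidable-stable)
  open import Relation.Binary.PropositionalEquality using (_≡_; refl; sym; trans; cong; cong₂; subst; subst₂; module ≡-Reasoning)

  ∣+m-+n∣ : ∀ m n → ℤ.∣ + m - + n ∣ ≡ ℕ.∣ m - n ∣
  ∣+m-+n∣ m n with ℕ.≤-total m n
  ... | inj₁ m≤n = trans (cong ℤ.∣_∣ (ℤ.m-n≡m⊖n m n)) (trans (ℤ.∣⊖∣-≤ m≤n) (sym (ℕ.m≤n⇒∣m-n∣≡n∸m m≤n)))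
  ... | inj₂ n≤m = trans (cong ℤ.∣_∣ (ℤ.m-n≡m⊖n m n)) (trans (ℤ.∣m⊖n∣≡∣n⊖m∣ m n)
                     (trans (ℤ.∣⊖∣-≤ n≤m) (sym (ℕ.m≤n⇒∣n-m∣≡n∸m n≤m))))

  mod⇒∣ : ∀ l r {M} → l ≡ r [mod M ] → + M ∣ + l - + r
  mod⇒∣ l r {M} h = ∣ᵤ⇒∣ (subst (M ∣ᵤ_) (sym (∣+m-+n∣ l r)) h)

  ∣⇒mod : ∀ l r {M} → + M ∣ + l - + r → l ≡ r [mod M ]
  ∣⇒mod l r {M} h = subst (M ∣ᵤ_) (∣+m-+n∣ l r) (∣⇒∣ᵤ h)

  pos-+₃ : ∀ l m n → + (l ℕ.+ m ℕ.+ n) ≡ + l + + m + + n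
  pos-+₃ l m n = trans (ℤ.pos-+ (l ℕ.+ m) n) (cong (_+ + n) (ℤ.pos-+ l m))

  residue : ∀ M .{{_ : NonZero M}} → ℤ → Fin M
  residue M i = fromℕ< (n%ℕd<d i M)

  residue-∣ : ∀ M .{{_ : NonZero M}} i → + M ∣ + toℕ (residue M i) - i
  residue-∣ M i = divides (- (i /ℕ M)) (begin
    + toℕ (residue M i) - i                                  ≡⟨ cong (λ m → + m - i) (toℕ-fromℕ< (n%ℕd<d i M)) ⟩
    + (i %ℕ M) - i                                           ≡⟨ cong (λ j → + (i %ℕ M) - j) (a≡a%ℕn+[a/ℕn]*n i M) ⟩
    + (i %ℕ M) - (+ (i %ℕ M) + (i /ℕ M) * + M)               ≡⟨ lemma (+ (i %ℕ M)) (i /ℕ M) (+ M) ⟩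
    - (i /ℕ M) * + M                                         ∎)
    where
    open ≡-Reasoning
    lemma : ∀ r d m → r - (r + d * m) ≡ - d * m
    lemma = solve-∀

  module _ {ℓ : Level} (𝒜 : FiniteAbelianGroup ℓ) where

    open FiniteAbelianGroup 𝒜
    open AbelianGroup abelianGroup using (identityˡ; identityʳ; inverseˡ; inverseʳ)
    open Mult (AbelianGroup.commutativeMonoid abelianGroup) using () renaming (_×_ to _·_)

    module Solution (q N : ℕ) (t : Carrier → Carrier → Carrier → ℤ/ q) (N>0 : 0 < N)
      (solution : Solvable 𝒜 q t N) where

      A B C : Carrier → ℤ
      A x = + toℕ (proj₁ solution x)
      B y = + toℕ (proj₁ (proj₂ solution) y)
      C z = + toℕ (proj₁ (proj₂ (proj₂ solution)) z)

      T : Carrier → Carrier → Carrier → ℤ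
      T x y z = + toℕ (t x y z)

      N∣qN : + N ∣ + (q ℕ.* N)
      N∣qN = ∣ᵤ⇒∣ (divides q refl)

      solves : ∀ x y z → x ⊕ y ⊕ z ≡ 0# → + (q ℕ.* N) ∣ (A x + B y + C z) - + N * T x y z
      solves x y z h = ∣-by
        (cong₂ _-_ (pos-+₃ i j l) (ℤ.pos-* N (toℕ (t x y z))))
        (mod⇒∣ (i ℕ.+ j ℕ.+ l) (N ℕ.* toℕ (t x y z)) (proj₂ (proj₂ (proj₂ solution)) x y z h))
        where
        i = toℕ (proj₁ solution x)
        j = toℕ (proj₁ (proj₂ solution) y)
        l = toℕ (proj₁ (proj₂ (proj₂ solution)) z)

      zero-mod-N : ∀ x y z → x ⊕ y ⊕ z ≡ 0# → + N ∣ A x + B y + C z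
      zero-mod-N x y z h = ∣-by (lemma (A x + B y + C z) (+ N) (T x y z))
        (∣m∣n⇒∣m+n (∣-trans N∣qN (solves x y z h)) (∣m⇒∣m*n (T x y z) ∣-refl))
        where
        lemma : ∀ s n t → s - n * t + n * t ≡ s
        lemma = solve-∀

      α : Carrier → ℤ
      α x = A x - A 0#

      private
        -- The triples (x ⊕ y , 0 , z) and (x , y , z) share the third entry z = ⊖ (x ⊕ y), so C
        -- cancels.
        B-shift : ∀ x y → + N ∣ (A (x ⊕ y) + B 0#) - (A x + B y)
        B-shift x y = ∣-by (lemma (A (x ⊕ y)) (B 0#) (C z) (A x) (B y))
          (∣m∣n⇒∣m-n (zero-mod-N (x ⊕ y) 0# z (trans (cong (_⊕ z) (identityʳ (x ⊕ y))) (inverseʳ (x ⊕ y))))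
                      (zero-mod-N x y z (inverseʳ (x ⊕ y))))
          where
          z = ⊖ (x ⊕ y)
          lemma : ∀ s b c a b′ → (s + b + c) - (a + b′ + c) ≡ (s + b) - (a + b′)
          lemma = solve-∀

      B≡α : ∀ y → + N ∣ (B y - B 0#) - α y
      B≡α y = ∣-by (lemma (A y) (B 0#) (A 0#) (B y))
        (∣m⇒∣-m (subst (λ s → + N ∣ (A s + B 0#) - (A 0# + B y)) (identityˡ y) (B-shift 0# y)))
        where
        lemma : ∀ s b a b′ → - ((s + b) - (a + b′)) ≡ (b′ - b) - (s - a)
        lemma = solve-∀

      α-additive : ∀ x y → + N ∣ α (x ⊕ y) - (α x + α y)
      α-additive x y = ∣-by (lemma (A (x ⊕ y)) (B 0#) (A x) (B y) (A 0#) (A y))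
        (∣m∣n⇒∣m+n (B-shift x y) (B≡α y))
        where
        lemma : ∀ s b a b′ z a′ → ((s + b) - (a + b′)) + ((b′ - b) - (a′ - z)) ≡ (s - z) - ((a - z) + (a′ - z))
        lemma = solve-∀

      -- Comparing the triples (⊖ z , 0 , z) and (0 , 0 , 0) gives C z - C 0 = - α (⊖ z) modulo N,
      -- and α is additive.
      C≡α : ∀ z → + N ∣ (C z - C 0#) - α z
      C≡α z = ∣-by (lemma (A (⊖ z)) (B 0#) (C z) (A 0#) (C 0#) (A z) (A (⊖ z ⊕ z)) (cong A (inverseˡ z)))
        (∣m∣n⇒∣m+n (∣m∣n⇒∣m-n (zero-mod-N (⊖ z) 0# z (trans (cong (_⊕ z) (identityʳ (⊖ z))) (inverseˡ z)))
          (zero-mod-N 0# 0# 0# (trans (cong (_⊕ 0#) (identityˡ 0#)) (identityˡ 0#)))) (α-additive (⊖ z) z))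
        where
        lemma′ : ∀ m b c a c₀ i → ((m + b + c) - (a + b + c₀)) + ((a - a) - ((m - a) + (i - a))) ≡ (c - c₀) - (i - a)
        lemma′ = solve-∀
        lemma : ∀ m b c a c₀ i s → s ≡ a → ((m + b + c) - (a + b + c₀)) + ((s - a) - ((m - a) + (i - a))) ≡ (c - c₀) - (i - a)
        lemma m b c a c₀ i s refl = lemma′ m b c a c₀ i

      -- Subtracting a lift of α from a, b and c leaves functions divisible by N.
      lift⇒solvable : (λ′ : Carrier → ℤ) → (∀ x y → + (q ℕ.* N) ∣ λ′ (x ⊕ y) - (λ′ x + λ′ y)) →
        (∀ x → + N ∣ λ′ x - α x) → .{{_ : NonZero q}} → Solvable 𝒜 q t 1
      lift⇒solvable λ′ λ-additive λ≡α = (λ x → residue (q ℕ.* 1) (a x)) , (λ y → residue (q ℕ.* 1) (b y)) , (λ z → residue (q ℕ.* 1) (c z)) , solves′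
        where
        instance
          q1≢0 : NonZero (q ℕ.* 1)
          q1≢0 = ℕ.m*n≢0 q 1
          N≢0 : NonZero N
          N≢0 = ℕ.>-nonZero N>0

        quotient-of : ∀ {i} → + N ∣ i → ∃ λ j → i ≡ j * + N
        quotient-of (divides j eq) = j , eq

        constant : ∃ λ j → A 0# + B 0# + C 0# ≡ j * + N
        constant = quotient-of (zero-mod-N 0# 0# 0# (trans (cong (_⊕ 0#) (identityˡ 0#)) (identityˡ 0#)))

        a′ : ∀ x → ∃ λ j → α x - λ′ x ≡ j * + N
        a′ x = quotient-of (∣-by (lemma (λ′ x) (α x)) (∣m⇒∣-m (λ≡α x)))
          where
          lemma : ∀ l i → - (l - i) ≡ i - l
          lemma = solve-∀
        b′ : ∀ y → ∃ λ j → (B y - B 0#) - λ′ y ≡ j * + N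
        b′ y = quotient-of (∣-by (lemma (B y - B 0#) (α y) (λ′ y)) (∣m∣n⇒∣m-n (B≡α y) (λ≡α y)))
          where
          lemma : ∀ b i l → (b - i) - (l - i) ≡ b - l
          lemma = solve-∀
        c′ : ∀ z → ∃ λ j → (C z - C 0#) - λ′ z ≡ j * + N
        c′ z = quotient-of (∣-by (lemma (C z - C 0#) (α z) (λ′ z)) (∣m∣n⇒∣m-n (C≡α z) (λ≡α z)))
          where
          lemma : ∀ b i l → (b - i) - (l - i) ≡ b - l
          lemma = solve-∀

        a b c : Carrier → ℤ
        -- `a′`, `b′` and `c′` divide functions normalised at 0; the sum of the three removed
        -- constants is divisible by N too, and its quotient is returned to a.
        a x = proj₁ (a′ x) + proj₁ constant
        b y = proj₁ (b′ y)
        c z = proj₁ (c′ z)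

        λ-zeroSum : ∀ x y z → x ⊕ y ⊕ z ≡ 0# → + (q ℕ.* N) ∣ λ′ x + λ′ y + λ′ z
        λ-zeroSum x y z h = ∣-by (lemma (λ′ x) (λ′ y) (λ′ z) (λ′ (x ⊕ y)) (λ′ (x ⊕ y ⊕ z)) (λ′ (0# ⊕ 0#)) (λ′ 0#) (cong λ′ h) (cong λ′ (identityˡ 0#)))
          (∣m⇒∣-m (∣m∣n⇒∣m+n (∣m∣n⇒∣m+n (λ-additive x y) (λ-additive (x ⊕ y) z)) (λ-additive 0# 0#)))
          where
          lemma′ : ∀ i j l s z → - (((s - (i + j)) + (z - (s + l))) + (z - (z + z))) ≡ i + j + l
          lemma′ = solve-∀
          lemma : ∀ i j l s z z′ z₀ → z ≡ z₀ → z′ ≡ z₀ → - (((s - (i + j)) + (z - (s + l))) + (z′ - (z₀ + z₀))) ≡ i + j + l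
          lemma i j l s z _ _ refl refl = lemma′ i j l s z

        abc-∣ : ∀ x y z → x ⊕ y ⊕ z ≡ 0# → + q ∣ (a x + b y + c z) - T x y z
        abc-∣ x y z h = *-cancelʳ-∣ (+ N) (subst₂ _∣_ (ℤ.pos-* q N) scaled (∣m∣n⇒∣m-n (solves x y z h) (λ-zeroSum x y z h)))
          where
          open ≡-Reasoning
          expand : ∀ a a₀ b b₀ c c₀ l m n N T → ((a + b + c) - N * T) - (l + m + n)
            ≡ ((a - a₀) - l) + (a₀ + b₀ + c₀) + ((b - b₀) - m) + ((c - c₀) - n) - N * T
          expand = solve-∀
          collect : ∀ i j k l N T → i * N + j * N + k * N + l * N - N * T ≡ (i + j + k + l - T) * N
          collect = solve-∀
          scaled : ((A x + B y + C z) - + N * T x y z) - (λ′ x + λ′ y + λ′ z) ≡ ((a x + b y + c z) - T x y z) * + N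
          scaled = begin
            _ ≡⟨ expand (A x) (A 0#) (B y) (B 0#) (C z) (C 0#) (λ′ x) (λ′ y) (λ′ z) (+ N) (T x y z) ⟩
            (α x - λ′ x) + (A 0# + B 0# + C 0#) + ((B y - B 0#) - λ′ y) + ((C z - C 0#) - λ′ z) - + N * T x y z
              ≡⟨ cong (_- + N * T x y z) (cong₂ _+_ (cong₂ _+_ (cong₂ _+_ (proj₂ (a′ x)) (proj₂ constant)) (proj₂ (b′ y))) (proj₂ (c′ z))) ⟩
            proj₁ (a′ x) * + N + proj₁ constant * + N + b y * + N + c z * + N - + N * T x y z
              ≡⟨ collect (proj₁ (a′ x)) (proj₁ constant) (b y) (c z) (+ N) (T x y z) ⟩
            ((a x + b y + c z) - T x y z) * + N ∎

        representative : ℤ → ℕ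
        representative i = toℕ (residue (q ℕ.* 1) i)

        solves′ : ∀ x y z → x ⊕ y ⊕ z ≡ 0# →
          representative (a x) ℕ.+ representative (b y) ℕ.+ representative (c z) ≡ 1 ℕ.* toℕ (t x y z) [mod q ℕ.* 1 ]
        solves′ x y z h = ∣⇒mod (i ℕ.+ j ℕ.+ l) (1 ℕ.* m) (∣-by
          (trans (lemma (+ i) (a x) (+ j) (b y) (+ l) (c z) (+ m))
            (cong₂ _-_ (sym (pos-+₃ i j l)) (cong +_ (sym (ℕ.*-identityˡ m)))))
          (∣m∣n⇒∣m+n (∣m∣n⇒∣m+n (∣m∣n⇒∣m+n (residue-∣ (q ℕ.* 1) (a x)) (residue-∣ (q ℕ.* 1) (b y)))
            (residue-∣ (q ℕ.* 1) (c z))) (subst (λ d → + d ∣ (a x + b y + c z) - T x y z) (sym (ℕ.*-identityʳ q)) (abc-∣ x y z h))))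
          where
          i = representative (a x)
          j = representative (b y)
          l = representative (c z)
          m = toℕ (t x y z)
          lemma : ∀ i a j b k c t → (i - a) + (j - b) + (k - c) + ((a + b + c) - t) ≡ (i + j + k) - t
          lemma = solve-∀

    -- The element is found by a decidable search. If the search fails, only a contradiction is
    -- needed, so a lift under double negation is enough.
    nonLiftable : ∀ p k N → Prime p → (t : Carrier → Carrier → Carrier → ℤ/ (p ^ suc k))
      (N>0 : 0 < N) (solution : Solvable 𝒜 (p ^ suc k) t N) → ¬ Solvable 𝒜 (p ^ suc k) t 1 →
      ∃ λ x → (p ^ suc k) · x ≡ 0# × ¬ + N ∣ Solution.α (p ^ suc k) N t N>0 solution x
    nonLiftable p k N p-prime t N>0 solution unsolvable
      with Any.any? (λ x → (((p ^ suc k) · x) ≟ 0#) ×-dec ¬? (+ N ∣? Solution.α (p ^ suc k) N t N>0 solution x)) elements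
    ... | yes found = satisfied found
    ... | no ¬found = contradiction
      (λ { (λ′ , λ-additive , λ≡α) → unsolvable (lift⇒solvable λ′ λ-additive λ≡α) })
      (Lifting.lift 𝒜 p k N p-prime N>0 α α-additive torsion)
      where
      open Solution (p ^ suc k) N t N>0 solution
      instance
        q≢0 : NonZero (p ^ suc k)
        q≢0 = ℕ.m^n≢0 p (suc k) {{prime⇒nonZero p-prime}}
      torsion : ∀ x → (p ^ suc k) · x ≡ 0# → + N ∣ α x
      torsion x qx≡0 = decidable-stable (+ N ∣? α x) λ N∤ → ¬found (lose (∈-elements x) (qx≡0 , N∤))

open Solutions

-- Label vectors, congruences and the bound for twisted sections.

module Sections where

  open import Level using (Level; 0ℓ)
  open import Algebra.Bundles using (AbelianGroup)
  import Algebra.Construct.DirectProduct as DirectProduct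
  import Algebra.Construct.Pointwise as Pointwise
  open import Data.Fin using (Fin; toℕ)
  open import Data.Fin.Properties using (all?; toℕ<n; toℕ-injective) renaming (_≟_ to _≟ᶠ_; suc-injective to fsuc-injective)
  open import Data.Nat using (ℕ; zero; suc; _+_; _*_; _^_; _≤_; _<_; _/_; z≤n; NonZero)
  open import Data.Nat.Properties
  open import Data.Nat.DivMod using (m/n*n≤m; m*n/n≡m; /-monoˡ-≤)
  open import Data.Nat.Divisibility using (∣⇒≤)
  open import Data.Integer as ℤ using (ℤ; +_; 0ℤ)
  import Data.Integer.Properties as ℤ
  open import Data.Integer.Divisibility.Signed using (_∣_; _∣?_; divides; ∣m∣n⇒∣m+n; ∣m∣n⇒∣m-n; ∣m⇒∣-m; *-cancelˡ-∣)
  open import Data.Integer.Tactic.RingSolver using (solve-∀)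
  import Data.Nat.Tactic.RingSolver as ℕ-Solver
  open import Data.List using (List; []; _∷_; length; allFin; cartesianProduct; cartesianProductWith)
  open import Data.List.Properties using (map-tabulate; length-tabulate)
  open import Data.List.Membership.Propositional using (_∈_)
  open import Data.List.Membership.Propositional.Properties using (∈-allFin; ∈-cartesianProductWith⁺)
  open import Data.List.Relation.Unary.Any using (here)
  open import Data.Product using (_×_; _,_; proj₁; proj₂)
  open import Data.Sum using (inj₁; inj₂)
  open import Data.Vec using (Vec; []; _∷_; lookup)
  open import Data.Vec.Properties using (tabulate∘lookup; tabulate-cong; ≡-dec)
  open import Relation.Nullary using (Dec; yes; no; ¬_; contradiction)
  open import Relation.Nullary.Decidable using (_×-dec_)
  open import Relation.Unary using (Pred; Decidable)
  open import Relation.Binary.Definitions using () renaming (Decidable to Decidable₂)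
  open import Relation.Binary.PropositionalEquality using (_≡_; refl; sym; trans; cong; cong₂; subst; subst₂; module ≡-Reasoning)

  private variable
    ℓa ℓp : Level
    A : Set ℓa

  -- An empty count is 0, and any other has a member relative to which the bound may be proved.
  -- Bounds on fibres thus reduce to comparing two elements.
  ∑χ-witness : ∀ {P : Pred A ℓp} (P? : Decidable P) xs {κ} →
    (∀ x → P x → (∑[ y ∈ xs ] χ (P? y)) ≤ κ) → (∑[ y ∈ xs ] χ (P? y)) ≤ κ
  ∑χ-witness P? xs h with ∑χ-any P? xs
  ... | inj₁ ≡0      = ≤-trans (≤-reflexive ≡0) z≤n
  ... | inj₂ (x , p) = h x p

  tuples : List A → ∀ n → List (Vec A n)
  tuples xs zero    = [] ∷ []
  tuples xs (suc n) = cartesianProductWith _∷_ xs (tuples xs n)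

  length-tuples : ∀ (xs : List A) n → length (tuples xs n) ≡ length xs ^ n
  length-tuples xs zero    = refl
  length-tuples xs (suc n) = begin
    length (tuples xs (suc n))                  ≡⟨ trans (∑-const (tuples xs (suc n)) 1) (*-identityʳ _) ⟨
    (∑[ _ ∈ tuples xs (suc n) ] 1)              ≡⟨ ∑-cartesianWith _∷_ xs (tuples xs n) _ ⟩
    (∑[ _ ∈ xs ] ∑[ _ ∈ tuples xs n ] 1)        ≡⟨ ∑-const xs _ ⟩
    length xs * (∑[ _ ∈ tuples xs n ] 1)        ≡⟨ cong (length xs *_) (trans (∑-const (tuples xs n) 1) (*-identityʳ _)) ⟩
    length xs * length (tuples xs n)            ≡⟨ cong (length xs *_) (length-tuples xs n) ⟩
    length xs ^ suc n                           ∎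
    where open ≡-Reasoning

  ∈-tuples : ∀ {xs : List A} → (∀ x → x ∈ xs) → ∀ {n} (v : Vec A n) → v ∈ tuples xs n
  ∈-tuples complete []      = here refl
  ∈-tuples complete (x ∷ v) = ∈-cartesianProductWith⁺ _∷_ (complete x) (∈-tuples complete v)

  -- The indicator is at most the product of the coordinate indicators, and the sum of a product
  -- over tuples factorises.
  ∑-tuples-≤ : ∀ (xs : List A) n {P : Fin n → Pred A ℓp} (P? : ∀ c → Decidable (P c)) {κ} →
    (∀ c → (∑[ x ∈ xs ] χ (P? c x)) ≤ κ) →
    ∀ {ℓq} {Q : Pred (Vec A n) ℓq} (Q? : Decidable Q) → (∀ {v} → Q v → ∀ c → P c (lookup v c)) →
    (∑[ v ∈ tuples xs n ] χ (Q? v)) ≤ κ ^ n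
  ∑-tuples-≤ xs zero    P? bound Q? Q⇒P = ≤-trans (≤-reflexive (+-identityʳ _)) (χ≤1 (Q? []))
  ∑-tuples-≤ xs (suc n) {P} P? {κ} bound Q? Q⇒P = begin
    (∑[ v ∈ tuples xs (suc n) ] χ (Q? v))                          ≡⟨ ∑-cartesianWith _∷_ xs (tuples xs n) _ ⟩
    (∑[ x ∈ xs ] ∑[ v ∈ tuples xs n ] χ (Q? (x ∷ v)))              ≤⟨ ∑-mono xs (λ x → ∑-mono (tuples xs n) λ v →
      χ-≤-* (Q? (x ∷ v)) (P? Fin.zero x) (rest? v) (λ Qv → Q⇒P Qv Fin.zero) (λ Qv c → Q⇒P Qv (Fin.suc c))) ⟩
    (∑[ x ∈ xs ] ∑[ v ∈ tuples xs n ] χ (P? Fin.zero x) * χ (rest? v))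
      ≡⟨ trans (∑-*ʳ xs _ _) (∑-cong xs λ x → ∑-*ˡ (χ (P? Fin.zero x)) (tuples xs n) _) ⟨
    (∑[ x ∈ xs ] χ (P? Fin.zero x)) * (∑[ v ∈ tuples xs n ] χ (rest? v))
      ≤⟨ *-mono-≤ (bound Fin.zero) (∑-tuples-≤ xs n (λ c → P? (Fin.suc c)) (λ c → bound (Fin.suc c)) rest? (λ h → h)) ⟩
    κ ^ suc n                                                      ∎
    where
    open ≤-Reasoning
    rest? : Decidable (λ v → ∀ c → P (Fin.suc c) (lookup v c))
    rest? v = all? λ c → P? (Fin.suc c) (lookup v c)

  lookup-injective : ∀ {n} {v w : Vec A n} → (∀ c → lookup v c ≡ lookup w c) → v ≡ w
  lookup-injective {v = v} {w} h = trans (sym (tabulate∘lookup v)) (trans (tabulate-cong h) (tabulate∘lookup w))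

  ∑-allFin-suc : ∀ n (f : Fin (suc n) → ℕ) → ∑ (allFin (suc n)) f ≡ f Fin.zero + (∑[ j ∈ allFin n ] f (Fin.suc j))
  ∑-allFin-suc n f = cong (λ m → f Fin.zero + m)
    (trans (cong (λ js → ∑ js f) (sym (map-tabulate (λ j → j) Fin.suc))) (∑-map Fin.suc (allFin n) f))

  allFin-unique : ∀ {n} (i : Fin n) → (∑[ j ∈ allFin n ] χ (i ≟ᶠ j)) ≤ 1
  allFin-unique {suc n} i = ≤-trans (≤-reflexive (∑-allFin-suc n _)) (split i)
    where
    split : ∀ i → χ (i ≟ᶠ Fin.zero) + (∑[ j ∈ allFin n ] χ (i ≟ᶠ Fin.suc j)) ≤ 1
    split Fin.zero    = +-monoʳ-≤ 1 (≤-reflexive (∑-zero (allFin n)))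
    split (Fin.suc i) = ≤-trans
      (∑-mono (allFin n) λ j → χ-mono (Fin.suc i ≟ᶠ Fin.suc j) (i ≟ᶠ j) fsuc-injective) (allFin-unique i)

  -- With f 0 = f n this rotates a sum over the residues modulo n by one place.
  ∑-telescope : ∀ n (f : ℕ → ℕ) → (∑[ j ∈ allFin n ] f (suc (toℕ j))) + f 0 ≡ (∑[ j ∈ allFin n ] f (toℕ j)) + f n
  ∑-telescope zero    f = refl
  ∑-telescope (suc n) f = begin
    (∑[ j ∈ allFin (suc n) ] f (suc (toℕ j))) + f 0             ≡⟨ cong (λ m → m + f 0) (∑-allFin-suc n _) ⟩
    f 1 + (∑[ j ∈ allFin n ] f (suc (suc (toℕ j)))) + f 0       ≡⟨ rearrange (f 1) _ (f 0) ⟩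
    f 0 + ((∑[ j ∈ allFin n ] f (suc (suc (toℕ j)))) + f 1)     ≡⟨ cong (λ m → f 0 + m) (∑-telescope n (λ m → f (suc m))) ⟩
    f 0 + ((∑[ j ∈ allFin n ] f (suc (toℕ j))) + f (suc n))     ≡⟨ +-assoc (f 0) _ _ ⟨
    f 0 + (∑[ j ∈ allFin n ] f (suc (toℕ j))) + f (suc n)       ≡⟨ cong (λ m → m + f (suc n)) (∑-allFin-suc n _) ⟨
    (∑[ j ∈ allFin (suc n) ] f (toℕ j)) + f (suc n)             ∎
    where
    open ≡-Reasoning
    rearrange : ∀ a b c → a + b + c ≡ c + (b + a)
    rearrange = ℕ-Solver.solve-∀

  -- Two consecutive residues cannot both be hit, since N ∤ r; N ∣ q r closes the cycle.
  ∑-progression-≤ : ∀ q N r → ¬ + N ∣ r → + N ∣ + q ℤ.* r → ∀ b →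
    (∑[ j ∈ allFin q ] χ (+ N ∣? (r ℤ.* (+ toℕ j ℤ.- b)))) ≤ q / 2
  ∑-progression-≤ q N r N∤r N∣qr b = begin
    S                     ≡⟨ m*n/n≡m S 2 ⟨
    S * 2 / 2             ≤⟨ /-monoˡ-≤ 2 2S≤q ⟩
    q / 2                 ∎
    where
    open ≤-Reasoning
    hit? : ∀ m → Dec (+ N ∣ r ℤ.* (+ m ℤ.- b))
    hit? m = + N ∣? (r ℤ.* (+ m ℤ.- b))
    f : ℕ → ℕ
    f m = χ (hit? m)
    S = ∑[ j ∈ allFin q ] f (toℕ j)
    cyclic : f 0 ≡ f q
    cyclic = ≤-antisym
      (χ-mono (hit? 0) (hit? q) λ h → ∣-by (shift r b (+ q)) (∣m∣n⇒∣m+n h N∣qr))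
      (χ-mono (hit? q) (hit? 0) λ h → ∣-by (unshift r b (+ q)) (∣m∣n⇒∣m-n h N∣qr))
      where
      shift : ∀ r b q → r ℤ.* (+ 0 ℤ.- b) ℤ.+ q ℤ.* r ≡ r ℤ.* (q ℤ.- b)
      shift = solve-∀
      unshift : ∀ r b q → r ℤ.* (q ℤ.- b) ℤ.- q ℤ.* r ≡ r ℤ.* (+ 0 ℤ.- b)
      unshift = solve-∀
    shifted : (∑[ j ∈ allFin q ] f (suc (toℕ j))) ≡ S
    shifted = +-cancelʳ-≡ (f 0) _ _ (trans (∑-telescope q f) (cong (λ m → S + m) (sym cyclic)))
    consecutive : ∀ m → f m + f (suc m) ≤ 1
    consecutive m with hit? m | hit? (suc m)
    ... | no _  | d     = χ≤1 d
    ... | yes _ | no _  = ≤-refl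
    ... | yes h | yes h′ = contradiction (∣-by (trans (cong (λ i → r ℤ.* (i ℤ.- b) ℤ.- r ℤ.* (+ m ℤ.- b)) (ℤ.pos-+ 1 m)) (difference r b (+ m)))
      (∣m∣n⇒∣m-n h′ h)) N∤r
      where
      difference : ∀ r b m → r ℤ.* (+ 1 ℤ.+ m ℤ.- b) ℤ.- r ℤ.* (m ℤ.- b) ≡ r
      difference = solve-∀
    2S≤q : S * 2 ≤ q
    2S≤q = begin
      S * 2                                                  ≡⟨ trans (*-comm S 2) (cong (λ m → S + m) (+-identityʳ S)) ⟩
      S + S                                                  ≡⟨ cong (λ m → S + m) shifted ⟨
      S + (∑[ j ∈ allFin q ] f (suc (toℕ j)))                ≡⟨ ∑-+ (allFin q) _ _ ⟨
      (∑[ j ∈ allFin q ] f (toℕ j) + f (suc (toℕ j)))        ≤⟨ ∑-bound (allFin q) (λ j → consecutive (toℕ j)) ⟩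
      length (allFin q) * 1                                  ≡⟨ trans (*-identityʳ _) (length-tabulate {n = q} (λ j → j)) ⟩
      q                                                      ∎

  residue-injective : ∀ {q} (i j : Fin q) → + q ∣ + toℕ i ℤ.- + toℕ j → i ≡ j
  residue-injective {q} i j h = toℕ-injective (small _ refl)
    where
    small : ∀ d → Data.Nat.∣ toℕ i - toℕ j ∣ ≡ d → toℕ i ≡ toℕ j
    small zero    ≡0 = ∣m-n∣≡0⇒m≡n ≡0
    small (suc d) ≡d = contradiction
      (≤-<-trans (∣m-n∣≤m⊔n (toℕ i) (toℕ j)) (⊔-lub (toℕ<n i) (toℕ<n j)))
      (≤⇒≯ (∣⇒≤ {{subst NonZero (sym ≡d) _}} (∣⇒mod (toℕ i) (toℕ j) h)))

  -- Congruence serves as the equality on ℤ, so representatives need not be reduced and the group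
  -- laws come from identities in ℤ.
  ℤmod : ℕ → AbelianGroup 0ℓ 0ℓ
  ℤmod m = record
    { Carrier = ℤ ; _≈_ = λ x y → + m ∣ x ℤ.- y ; _∙_ = ℤ._+_ ; ε = 0ℤ ; _⁻¹ = ℤ.-_
    ; isAbelianGroup = record
      { isGroup = record
        { isMonoid = record
          { isSemigroup = record
            { isMagma = record
              { isEquivalence = record
                { refl  = λ {x} → reflexive {x} refl
                ; sym   = λ {x} {y} h → ∣-by (swap x y) (∣m⇒∣-m h)
                ; trans = λ {x} {y} {z} h h′ → ∣-by (join x y z) (∣m∣n⇒∣m+n h h′)
                }
              ; ∙-cong = λ {x} {y} {z} {w} h h′ → ∣-by (add x y z w) (∣m∣n⇒∣m+n h h′)
              }
            ; assoc = λ x y z → reflexive (ℤ.+-assoc x y z)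
            }
          ; identity = (λ x → reflexive (ℤ.+-identityˡ x)) , λ x → reflexive (ℤ.+-identityʳ x)
          }
        ; inverse = (λ x → reflexive (ℤ.+-inverseˡ x)) , λ x → reflexive (ℤ.+-inverseʳ x)
        ; ⁻¹-cong = λ {x} {y} h → ∣-by (negate x y) (∣m⇒∣-m h)
        }
      ; comm = λ x y → reflexive (ℤ.+-comm x y)
      }
    }
    where
    reflexive : ∀ {x y} → x ≡ y → + m ∣ x ℤ.- y
    reflexive {x} refl = divides 0ℤ (trans (ℤ.+-inverseʳ x) (sym (ℤ.*-zeroˡ (+ m))))
    swap : ∀ x y → ℤ.- (x ℤ.- y) ≡ y ℤ.- x
    swap = solve-∀
    join : ∀ x y z → (x ℤ.- y) ℤ.+ (y ℤ.- z) ≡ x ℤ.- z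
    join = solve-∀
    add : ∀ x y z w → (x ℤ.- y) ℤ.+ (z ℤ.- w) ≡ (x ℤ.+ z) ℤ.- (y ℤ.+ w)
    add = solve-∀
    negate : ∀ x y → ℤ.- (x ℤ.- y) ≡ ℤ.- x ℤ.- ℤ.- y
    negate = solve-∀

  module TwistedSections (q N n : ℕ) .{{_ : NonZero q}} (r : ℤ) (N∤r : ¬ + N ∣ r) (N∣qr : + N ∣ + q ℤ.* r) where

    V : AbelianGroup 0ℓ 0ℓ
    V = Pointwise.abelianGroup (Fin n) (DirectProduct.abelianGroup (ℤmod q) (ℤmod (q * N)))

    open AbelianGroup V using (_≈_; _∙_; ε; _-_) renaming (sym to ≈-sym; trans to ≈-trans)

    infix 4 _≈?_
    _≈?_ : Decidable₂ _≈_
    v ≈? w = all? λ c → (+ q ∣? (proj₁ (v c) ℤ.- proj₁ (w c))) ×-dec (+ (q * N) ∣? (proj₂ (v c) ℤ.- proj₂ (w c)))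

    open AdditiveTriples V _≈?_

    is : List (Vec (Fin q) n)
    is = tuples (allFin q) n

    |is| : length is ≡ q ^ n
    |is| = trans (length-tuples (allFin q) n) (cong (_^ n) (length-tabulate {n = q} (λ j → j)))

    -- Carrying the label as first coordinate makes every section injective and makes the condition
    -- i + j + l = 0 part of the equation in `V`.
    labelled : (Vec (Fin q) n → Fin n → ℤ) → Vec (Fin q) n → Fin n → ℤ × ℤ
    labelled Φ i c = + toℕ (lookup i c) , Φ i c

    label-injective : ∀ {i j : Vec (Fin q) n} → (∀ c → + q ∣ + toℕ (lookup i c) ℤ.- + toℕ (lookup j c)) → i ≡ j
    label-injective h = lookup-injective λ c → residue-injective _ _ (h c)

    is-unique : ∀ i → (∑[ j ∈ is ] χ (≡-dec _≟ᶠ_ i j)) ≤ 1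
    is-unique i = ≤-trans (∑-tuples-≤ (allFin q) n (λ c j → lookup i c ≟ᶠ j) (λ c → allFin-unique (lookup i c))
      (λ j → ≡-dec _≟ᶠ_ i j) (λ { refl c → refl })) (≤-reflexive (^-zeroˡ n))

    labelled-inj : ∀ Φ v → (∑[ i ∈ is ] χ (labelled Φ i ≈? v)) ≤ 1
    labelled-inj Φ v = ∑χ-witness (λ i → labelled Φ i ≈? v) is λ i i≈v → ≤-trans
      (∑-mono is λ j → χ-mono (labelled Φ j ≈? v) (≡-dec _≟ᶠ_ i j)
        λ j≈v → label-injective λ c → proj₁ (≈-trans {labelled Φ i} {v} {labelled Φ j} i≈v (≈-sym {labelled Φ j} {v} j≈v) c))
      (is-unique i)

    ·-proj₁ : ∀ m v c → proj₁ ((m · v) c) ≡ + m ℤ.* proj₁ (v c)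
    ·-proj₁ zero    v c = sym (ℤ.*-zeroˡ (proj₁ (v c)))
    ·-proj₁ (suc m) v c = trans (cong (λ i → proj₁ (v c) ℤ.+ i) (·-proj₁ m v c))
      (trans (step (proj₁ (v c)) (+ m)) (cong (ℤ._* proj₁ (v c)) (sym (ℤ.pos-+ 1 m))))
      where
      step : ∀ w m → w ℤ.+ m ℤ.* w ≡ (+ 1 ℤ.+ m) ℤ.* w
      step = solve-∀

    ·-proj₂ : ∀ m v c → proj₂ ((m · v) c) ≡ + m ℤ.* proj₂ (v c)
    ·-proj₂ zero    v c = sym (ℤ.*-zeroˡ (proj₂ (v c)))
    ·-proj₂ (suc m) v c = trans (cong (λ i → proj₂ (v c) ℤ.+ i) (·-proj₂ m v c))
      (trans (step (proj₂ (v c)) (+ m)) (cong (ℤ._* proj₂ (v c)) (sym (ℤ.pos-+ 1 m))))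
      where
      step : ∀ w m → w ℤ.+ m ℤ.* w ≡ (+ 1 ℤ.+ m) ℤ.* w
      step = solve-∀

    module _ (N>0 : 0 < N) (Φ Ψ Θ : Vec (Fin q) n → Fin n → ℤ) (s : Fin n → ℤ)
      (twisted : ∀ i c → + N ∣ Φ i c ℤ.- (s c ℤ.- r ℤ.* + toℕ (lookup i c))) where

      private
        I : Set
        I = Vec (Fin q) n

        F : I → Fin n → ℤ × ℤ
        F = labelled Φ

        κ : ℕ
        κ = (q / 2) ^ n

        Close : I → I → Fin n → Set
        Close b a c = + N ∣ r ℤ.* (+ toℕ (lookup a c) ℤ.- + toℕ (lookup b c))

        X : I → I × I → Fin n → ℤ × ℤ
        X d (x , a) = F x ∙ (q · (F d - F a)) - F d

        close? : ∀ b → Decidable (λ a → ∀ c → Close b a c)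
        close? b a = all? λ c → + N ∣? (r ℤ.* (+ toℕ (lookup a c) ℤ.- + toℕ (lookup b c)))

        close-bound : ∀ b → (∑[ a ∈ is ] χ (close? b a)) ≤ κ
        close-bound b = ∑-tuples-≤ (allFin q) n (λ c j → + N ∣? (r ℤ.* (+ toℕ j ℤ.- + toℕ (lookup b c))))
          (λ c → ∑-progression-≤ q N r N∤r N∣qr (+ toℕ (lookup b c))) (close? b) (λ h → h)

        -- In the first coordinate the term multiplied by q vanishes modulo q, so only x and d
        -- contribute.
        X-label : ∀ d x a x₀ a₀ → X d (x , a) ≈ X d (x₀ , a₀) → x₀ ≡ x
        X-label d x a x₀ a₀ h = label-injective λ c → ∣-by
          (trans (cong₂ (λ m m₀ → ℤ.- (((l x c ℤ.+ m) ℤ.- l d c) ℤ.- ((l x₀ c ℤ.+ m₀) ℤ.- l d c)) ℤ.+ + q ℤ.* (l a₀ c ℤ.- l a c))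
              (·-proj₁ q (F d - F a) c) (·-proj₁ q (F d - F a₀) c))
            (cancel (l x c) (l x₀ c) (l d c) (l a c) (l a₀ c) (+ q)))
          (∣m∣n⇒∣m+n (∣m⇒∣-m (proj₁ (h c))) (divides (l a₀ c ℤ.- l a c) (ℤ.*-comm (+ q) _)))
          where
          l : I → Fin n → ℤ
          l i c = + toℕ (lookup i c)
          cancel : ∀ x x₀ d a a₀ q →
            ℤ.- (((x ℤ.+ q ℤ.* (d ℤ.- a)) ℤ.- d) ℤ.- ((x₀ ℤ.+ q ℤ.* (d ℤ.- a₀)) ℤ.- d)) ℤ.+ q ℤ.* (a₀ ℤ.- a) ≡ x₀ ℤ.- x
          cancel = solve-∀

        -- In the second coordinate a factor q cancels from the modulus qN; what is left is Φ a = Φ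
        -- a₀ modulo N, where Φ is affine of slope - r in the label.
        X-close : ∀ d x a a₀ → X d (x , a) ≈ X d (x , a₀) → ∀ c → Close a₀ a c
        X-close d x a a₀ h c = ∣-by (combine (Φ a c) (Φ a₀ c) (s c) r (+ toℕ (lookup a c)) (+ toℕ (lookup a₀ c)))
          (∣m∣n⇒∣m+n (∣m∣n⇒∣m-n Φ≡ (twisted a₀ c)) (twisted a c))
          where
          combine : ∀ p p₀ s r a a₀ → (p₀ ℤ.- p) ℤ.- (p₀ ℤ.- (s ℤ.- r ℤ.* a₀)) ℤ.+ (p ℤ.- (s ℤ.- r ℤ.* a)) ≡ r ℤ.* (a ℤ.- a₀)
          combine = solve-∀
          cancel : ∀ x d a a₀ q →
            ((x ℤ.+ q ℤ.* (d ℤ.- a)) ℤ.- d) ℤ.- ((x ℤ.+ q ℤ.* (d ℤ.- a₀)) ℤ.- d) ≡ q ℤ.* (a₀ ℤ.- a)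
          cancel = solve-∀
          Φ≡ : + N ∣ Φ a₀ c ℤ.- Φ a c
          Φ≡ = *-cancelˡ-∣ (+ q) (subst₂ _∣_ (ℤ.pos-* q N)
            (trans (cong₂ (λ m m₀ → ((Φ x c ℤ.+ m) ℤ.- Φ d c) ℤ.- ((Φ x c ℤ.+ m₀) ℤ.- Φ d c))
                (·-proj₂ q (F d - F a) c) (·-proj₂ q (F d - F a₀) c))
              (cancel (Φ x c) (Φ d c) (Φ a c) (Φ a₀ c) (+ q)))
            (proj₂ (h c)))

        -- Relative to one hit (x₀ , a₀), the vector x is fixed and each coordinate of a is confined
        -- to at most q / 2 residues.
        multiplicity : ∀ d v → (∑[ p ∈ cartesianProduct is is ] χ (X d p ≈? v)) ≤ κ
        multiplicity d v = ∑χ-witness (λ p → X d p ≈? v) (cartesianProduct is is) λ { (x₀ , a₀) h₀ → begin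
          (∑[ p ∈ cartesianProduct is is ] χ (X d p ≈? v))
            ≤⟨ ∑-mono (cartesianProduct is is) (λ { (x , a) → χ-≤-* (X d (x , a) ≈? v) (≡-dec _≟ᶠ_ x₀ x) (close? a₀ a)
                 (λ h → X-label d x a x₀ a₀ (joined h h₀))
                 (λ h → X-close′ d x a x₀ a₀ (joined h h₀)) }) ⟩
          (∑[ p ∈ cartesianProduct is is ] χ (≡-dec _≟ᶠ_ x₀ (proj₁ p)) * χ (close? a₀ (proj₂ p)))
            ≡⟨ ∑-cartesian-* is is _ _ ⟩
          (∑[ x ∈ is ] χ (≡-dec _≟ᶠ_ x₀ x)) * (∑[ a ∈ is ] χ (close? a₀ a))
            ≤⟨ *-mono-≤ (is-unique x₀) (close-bound a₀) ⟩
          1 * κ  ≡⟨ *-identityˡ κ ⟩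
          κ      ∎ }
          where
          open ≤-Reasoning
          joined : ∀ {p p₀} → X d p ≈ v → X d p₀ ≈ v → X d p ≈ X d p₀
          joined {p} {p₀} h h₀ = ≈-trans {X d p} {v} {X d p₀} h (≈-sym {X d p₀} {v} h₀)
          X-close′ : ∀ d x a x₀ a₀ → X d (x , a) ≈ X d (x₀ , a₀) →
            ∀ c → Close a₀ a c
          X-close′ d x a x₀ a₀ h with X-label d x a x₀ a₀ h
          ... | refl = X-close d x a a₀ h

      solutions : ℕ
      solutions = zeroSums is (∈-tuples ∈-allFin) F (labelled Ψ) (labelled Θ)
        (labelled-inj Φ) (labelled-inj Ψ) (labelled-inj Θ)

      -- q ^ n * q ^ n is the trivial bound, since two labels determine the third. The gain 2 ^ n is
      -- q ^ n against κ = (q / 2) ^ n.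
      solutions-bound : 2 ^ n * solutions ^ (8 * 2 ^ q) ≤ (q ^ n * q ^ n) ^ (8 * 2 ^ q)
      solutions-bound = *-cancelˡ-≤ (q ^ n) {{m^n≢0 q n}} (begin
        q ^ n * (2 ^ n * solutions ^ k)        ≡⟨ regroup (q ^ n) (2 ^ n) (solutions ^ k) ⟩
        2 ^ n * (q ^ n * solutions ^ k)        ≤⟨ *-monoʳ-≤ (2 ^ n) core ⟩
        2 ^ n * (κ * (q ^ n) ^ (16 * 2 ^ q))   ≡⟨ *-assoc (2 ^ n) κ _ ⟨
        2 ^ n * κ * (q ^ n) ^ (16 * 2 ^ q)     ≤⟨ *-monoˡ-≤ _ halves ⟩
        q ^ n * (q ^ n) ^ (16 * 2 ^ q)         ≡⟨ cong (λ m → q ^ n * (q ^ n) ^ m) (double (2 ^ q)) ⟩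
        q ^ n * (q ^ n) ^ (k + k)              ≡⟨ cong (q ^ n *_) (trans (^-distribˡ-+-* (q ^ n) k k) (sym (^-distribʳ-* k (q ^ n) (q ^ n)))) ⟩
        q ^ n * (q ^ n * q ^ n) ^ k            ∎)
        where
        open ≤-Reasoning
        k = 8 * 2 ^ q
        core : q ^ n * solutions ^ k ≤ κ * (q ^ n) ^ (16 * 2 ^ q)
        core = subst (λ m → m * solutions ^ k ≤ κ * m ^ (16 * 2 ^ q)) |is|
          (zeroSums-bound is (∈-tuples ∈-allFin) F (labelled Ψ) (labelled Θ)
            (labelled-inj Φ) (labelled-inj Ψ) (labelled-inj Θ) q κ multiplicity)
        halves : 2 ^ n * κ ≤ q ^ n
        halves = subst (_≤ q ^ n) (^-distribʳ-* n 2 (q / 2))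
          (^-monoˡ-≤ n (≤-trans (≤-reflexive (*-comm 2 (q / 2))) (m/n*n≤m q 2)))
        regroup : ∀ a b c → a * (b * c) ≡ b * (a * c)
        regroup = ℕ-Solver.solve-∀
        double : ∀ m → 16 * m ≡ 8 * m + 8 * m
        double = ℕ-Solver.solve-∀

open Sections

-- Averaging over shifts by multiples of e, and the passage to probabilities.

module Averages where

  open import Level using (Level)
  open import Algebra.Bundles using (AbelianGroup; module AbelianGroup)
  import Algebra.Properties.AbelianGroup as AbelianGroupProperties
  import Algebra.Properties.CommutativeSemigroup as CommutativeSemigroupProperties
  import Algebra.Properties.CommutativeMonoid.Mult as Mult
  open import Algebra.Definitions.RawSemiring using () renaming (_^_ to pow)
  open import Data.Fin using (Fin; toℕ)
  open import Data.Fin.Properties using (all?) renaming (_≟_ to _≟ᶠ_)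
  open import Data.Integer as ℤ using (ℤ; +_; 0ℤ)
  import Data.Integer.Properties as ℤ
  open import Data.Integer.Divisibility.Signed using (_∣_; _∣?_; divides; ∣m∣n⇒∣m-n; *-monoʳ-∣; ∣⇒∣ᵤ)
  open import Data.Integer.Tactic.RingSolver using (solve-∀)
  import Data.Nat.Tactic.RingSolver as ℕ-Solver
  open import Data.List using (List; []; _∷_; length; filter; allFin; cartesianProduct; cartesianProductWith)
  open import Data.List.Membership.Propositional using (_∈_)
  open import Data.List.Membership.Propositional.Properties using (∈-allFin)
  open import Data.Nat using (ℕ; zero; suc; _+_; _*_; _^_; _≤_; _<_; z≤n; s≤s; NonZero; pred)
  open import Data.Nat.Coprimality using (1-coprimeTo)
  open import Data.Nat.Divisibility using () renaming (divides to divides′; _∣_ to _∣ᵤ_)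
  open import Data.Nat.Primality using (Prime; prime⇒nonZero)
  open import Data.Nat.Properties hiding (_≟_)
  open import Data.Product using (_×_; _,_; proj₁; proj₂; ∃)
  open import Data.Sum using (inj₁; inj₂)
  open import Data.Rational as ℚ using (ℚ; mkℚ; 0ℚ; 1ℚ; toℚᵘ)
  import Data.Rational.Properties as ℚ
  open import Data.Rational.Unnormalised as ℚᵘ using (mkℚᵘ; _≃_; *≡*; *≤*)
  import Data.Rational.Unnormalised.Properties as ℚᵘ
  open import Data.Vec using (Vec; []; _∷_; lookup; tabulate; zipWith; replicate)
  open import Data.Vec.Properties using (lookup-zipWith; lookup-replicate; lookup∘tabulate; ≡-dec)
  open import Function using (module Inverse)
  open import Relation.Nullary using (yes; no; ¬_)
  open import Relation.Unary using (Decidable)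
  open import Relation.Binary.Definitions using (DecidableEquality)
  open import Relation.Binary.PropositionalEquality using (_≡_; refl; sym; trans; cong; cong₂; subst; subst₂; module ≡-Reasoning)

  private variable
    ℓa : Level
    S : Set ℓa

  -- The term at x is charged to ψ x, a preimage of x under φ; uniqueness in xs ensures that no y is
  -- charged for more than the one value φ y.
  ∑-reindex : ∀ (_≟_ : DecidableEquality S) {xs : List S} → (∀ x → x ∈ xs) →
    (∀ z → (∑[ x ∈ xs ] χ (z ≟ x)) ≤ 1) → (φ ψ : S → S) → (∀ x → φ (ψ x) ≡ x) →
    ∀ g → ∑ xs g ≤ (∑[ x ∈ xs ] g (φ x))
  ∑-reindex _≟_ {xs} complete unique φ ψ φ∘ψ g = begin
    ∑ xs g                                                ≤⟨ ∑-mono xs hit ⟩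
    (∑[ x ∈ xs ] ∑[ y ∈ xs ] χ (φ y ≟ x) * g (φ y))       ≡⟨ ∑-swap xs xs _ ⟩
    (∑[ y ∈ xs ] ∑[ x ∈ xs ] χ (φ y ≟ x) * g (φ y))       ≡⟨ ∑-cong xs (λ y → ∑-*ʳ xs _ (g (φ y))) ⟨
    (∑[ y ∈ xs ] (∑[ x ∈ xs ] χ (φ y ≟ x)) * g (φ y))     ≤⟨ ∑-mono xs (λ y → *-monoˡ-≤ (g (φ y)) (unique (φ y))) ⟩
    (∑[ y ∈ xs ] 1 * g (φ y))                             ≡⟨ ∑-cong xs (λ y → *-identityˡ (g (φ y))) ⟩
    (∑[ y ∈ xs ] g (φ y))                                 ∎
    where
    open ≤-Reasoning
    hit : ∀ x → g x ≤ (∑[ y ∈ xs ] χ (φ y ≟ x) * g (φ y))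
    hit x = begin
      g x                                     ≡⟨ *-identityˡ (g x) ⟨
      1 * g x                                 ≡⟨ cong₂ _*_ (χ-yes (φ (ψ x) ≟ x) (φ∘ψ x)) (cong g (φ∘ψ x)) ⟨
      χ (φ (ψ x) ≟ x) * g (φ (ψ x))           ≤⟨ ∑-∈ (λ y → χ (φ y ≟ x) * g (φ y)) (complete (ψ x)) ⟩
      (∑[ y ∈ xs ] χ (φ y ≟ x) * g (φ y))     ∎

  ∑≤length*max : ∀ (x : S) xs (f : S → ℕ) → ∃ λ y → ∑ (x ∷ xs) f ≤ length (x ∷ xs) * f y
  ∑≤length*max x []        f = x , ≤-reflexive refl
  ∑≤length*max x (x′ ∷ xs) f with ∑≤length*max x′ xs f
  ... | y , h with ≤-total (f x) (f y)
  ...   | inj₁ fx≤fy = y , +-mono-≤ fx≤fy h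
  ...   | inj₂ fy≤fx = x , +-monoʳ-≤ (f x) (≤-trans h (*-monoʳ-≤ (length (x′ ∷ xs)) fy≤fx))

  -- There are no k-th roots in ℕ to take before summing; instead the sum is bounded by its length
  -- times its largest term, for which the power bound is known.
  ∑-power-≤ : ∀ (xs : List S) .{{_ : NonZero (length xs)}} (f : S → ℕ) k {B C} →
    (∀ x → C * f x ^ k ≤ B ^ k) → C * ∑ xs f ^ k ≤ (length xs * B) ^ k
  ∑-power-≤ (x ∷ xs) f k {B} {C} bound with ∑≤length*max x xs f
  ... | y , h = begin
    C * ∑ (x ∷ xs) f ^ k      ≤⟨ *-monoʳ-≤ C (^-monoˡ-≤ k h) ⟩
    C * (l * f y) ^ k         ≡⟨ cong (C *_) (^-distribʳ-* k l (f y)) ⟩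
    C * (l ^ k * f y ^ k)     ≡⟨ regroup C (l ^ k) (f y ^ k) ⟩
    l ^ k * (C * f y ^ k)     ≤⟨ *-monoʳ-≤ (l ^ k) (bound y) ⟩
    l ^ k * B ^ k             ≡⟨ ^-distribʳ-* k l B ⟨
    (l * B) ^ k               ∎
    where
    open ≤-Reasoning
    l = length (x ∷ xs)
    regroup : ∀ a b c → a * (b * c) ≡ b * (a * c)
    regroup = ℕ-Solver.solve-∀

  fraction-* : ∀ a b c d .{{_ : NonZero b}} .{{_ : NonZero d}} →
    ((+ a) ℚᵘ./ b) ℚᵘ.* ((+ c) ℚᵘ./ d) ≃ (ℚᵘ._/_ (+ (a * c)) (b * d) {{m*n≢0 b d}})
  fraction-* a (suc b) c (suc d) = *≡* (cong (ℤ._* + (suc b * suc d)) (sym (ℤ.pos-* a c)))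

  toℚᵘ-/ : ∀ a b .{{_ : NonZero b}} → toℚᵘ ((+ a) ℚ./ b) ≃ ((+ a) ℚᵘ./ b)
  toℚᵘ-/ a (suc b) = ℚ.toℚᵘ-fromℚᵘ (mkℚᵘ (+ a) b)

  -- The quotient in ℚ is reduced to lowest terms, so powers are computed with unnormalised
  -- fractions, whose numerators and denominators multiply separately.
  toℚᵘ-pow : ∀ a b .{{_ : NonZero b}} m →
    toℚᵘ (pow ℚ.+-*-rawSemiring ((+ a) ℚ./ b) m) ≃ (ℚᵘ._/_ (+ (a ^ m)) (b ^ m) {{m^n≢0 b m}})
  toℚᵘ-pow a b zero    = *≡* refl
  toℚᵘ-pow a b (suc m) = ℚᵘ.≃-trans (ℚ.toℚᵘ-homo-* ((+ a) ℚ./ b) (pow ℚ.+-*-rawSemiring ((+ a) ℚ./ b) m))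
    (ℚᵘ.≃-trans (ℚᵘ.*-cong (toℚᵘ-/ a b) (toℚᵘ-pow a b m)) (fraction-* a b (a ^ m) (b ^ m) {{_}} {{m^n≢0 b m}}))

  fraction≤1 : ∀ a b .{{_ : NonZero b}} → a ≤ b → ((+ a) ℚᵘ./ b) ℚᵘ.≤ ℚᵘ.1ℚᵘ
  fraction≤1 a (suc b) a≤b = *≤* (subst₂ ℤ._≤_ (sym (ℤ.*-identityʳ (+ a))) (sym (ℤ.*-identityˡ (+ suc b))) (ℤ.+≤+ a≤b))

  pow-≤1 : ∀ a b .{{_ : NonZero b}} m X → X * a ^ m ≤ b ^ m →
    pow ℚ.+-*-rawSemiring ((+ a) ℚ./ b) m ℚ.* ((+ X) ℚ./ 1) ℚ.≤ 1ℚ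
  pow-≤1 a b m X h = ℚ.toℚᵘ-cancel-≤ (ℚᵘ.≤-respˡ-≃ (ℚᵘ.≃-sym
    (ℚᵘ.≃-trans (ℚ.toℚᵘ-homo-* (pow ℚ.+-*-rawSemiring ((+ a) ℚ./ b) m) ((+ X) ℚ./ 1))
    (ℚᵘ.≃-trans (ℚᵘ.*-cong (toℚᵘ-pow a b m) (toℚᵘ-/ X 1)) (fraction-* (a ^ m) (b ^ m) X 1 {{m^n≢0 b m}}))))
    (fraction≤1 (a ^ m * X) (b ^ m * 1) {{m*n≢0 (b ^ m) 1 {{m^n≢0 b m}}}}
      (≤-trans (≤-reflexive (*-comm (a ^ m) X)) (≤-trans h (≤-reflexive (sym (*-identityʳ (b ^ m))))))))

  -- The fraction 1 / (8 · 2 ^ q), the reciprocal of the exponent in `winning-bound`. `mkℚ` stores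
  -- the denominator minus one.
  decayRate : ℕ → ℚ
  decayRate q = mkℚ (+ 1) (pred (8 * 2 ^ q)) (1-coprimeTo _)

  decayRate-positive : ∀ q → 0ℚ ℚ.< decayRate q
  decayRate-positive q = ℚ.positive⁻¹ (decayRate q)

  module _ {ℓ : Level} (𝒜 : FiniteAbelianGroup ℓ) where

    open FiniteAbelianGroup 𝒜
    open AbelianGroup abelianGroup using (identityˡ; identityʳ)
    open AbelianGroupProperties abelianGroup using (//-rightDividesˡ)
    open CommutativeSemigroupProperties (AbelianGroup.commutativeSemigroup abelianGroup) using (interchange)
    open Mult (AbelianGroup.commutativeMonoid abelianGroup) using (×-homo-+; ×-assocˡ) renaming (_×_ to _·_)

    vectors≡tuples : ∀ n → vectors 𝒜 n ≡ tuples elements n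
    vectors≡tuples zero    = refl
    vectors≡tuples (suc n) = cong (cartesianProductWith _∷_ elements) (vectors≡tuples n)

    elements-unique : ∀ z → (∑[ x ∈ elements ] χ (z ≟ x)) ≤ 1
    elements-unique z = ≤-trans (≤-reflexive (∑-map (Inverse.from finite) (allFin order) _))
      (≤-trans (∑-mono (allFin order) λ j → χ-mono (z ≟ Inverse.from finite j) (Inverse.to finite z ≟ᶠ j)
        λ { refl → Inverse.strictlyInverseˡ finite j }) (allFin-unique (Inverse.to finite z)))

    vectors-unique : ∀ n z → (∑[ x ∈ vectors 𝒜 n ] χ (≡-dec _≟_ z x)) ≤ 1
    vectors-unique n z = subst (λ vs → (∑[ x ∈ vs ] χ (≡-dec _≟_ z x)) ≤ 1) (sym (vectors≡tuples n))
      (≤-trans (∑-tuples-≤ elements n (λ c x → lookup z c ≟ x) (λ c → elements-unique (lookup z c))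
        (≡-dec _≟_ z) (λ { refl c → refl })) (≤-reflexive (^-zeroˡ n)))

    module Averaging (q N : ℕ) .{{_ : NonZero q}} (t : Carrier → Carrier → Carrier → ℤ/ q) (N>0 : 0 < N)
      (solution : Solvable 𝒜 q t N) (e : Carrier) (qe≡0 : q · e ≡ 0#)
      (N∤r : ¬ + N ∣ Solution.α 𝒜 q N t N>0 solution e)
      (n : ℕ) (f g h : Vec Carrier n → Vec (ℤ/ q) n)
      where

      open Solution 𝒜 q N t N>0 solution
      open Additive 𝒜 N α α-additive

      r : ℤ
      r = α e

      N∣qr : + N ∣ + q ℤ.* r
      N∣qr = ∣-by (lemma (α (q · e)) (+ q ℤ.* r)) (∣m∣n⇒∣m-n (subst (λ x → + N ∣ α x) (sym qe≡0) α-0) (α-· q e))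
        where
        lemma : ∀ i j → i ℤ.- (i ℤ.- j) ≡ j
        lemma = solve-∀

      open TwistedSections q N n r N∤r N∣qr

      infixl 6 _⊞_
      _⊞_ : Vec Carrier n → Vec (Fin q) n → Vec Carrier n
      _⊞_ = zipWith λ a j → a ⊕ toℕ j · e

      _⊟_ : Vec Carrier n → Vec (Fin q) n → Vec Carrier n
      _⊟_ = zipWith λ a j → a ⊕ ⊖ (toℕ j · e)

      lookup-⊞ : ∀ x i c → lookup (x ⊞ i) c ≡ lookup x c ⊕ toℕ (lookup i c) · e
      lookup-⊞ x i c = lookup-zipWith _ c x i

      ⊟-⊞ : ∀ i x → (x ⊟ i) ⊞ i ≡ x
      ⊟-⊞ i x = lookup-injective λ c → trans (lookup-⊞ (x ⊟ i) i c)
        (trans (cong (_⊕ toℕ (lookup i c) · e) (lookup-zipWith _ c x i)) (//-rightDividesˡ _ _))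

      -- In N f - A the function t drops out of the winning condition modulo qN, while modulo N the
      -- unknown f drops out, leaving - A, which is affine along multiples of e.
      twist : (Vec Carrier n → Vec (ℤ/ q) n) → (Carrier → ℤ) → Vec Carrier n → Vec (Fin q) n → Fin n → ℤ
      twist f A x i c = + N ℤ.* + toℕ (lookup (f (x ⊞ i)) c) ℤ.- A (lookup (x ⊞ i) c)

      twisted : ∀ x i c → + N ∣ twist f A x i c ℤ.- (ℤ.- A (lookup x c) ℤ.- r ℤ.* + toℕ (lookup i c))
      twisted x i c = ∣-by (lemma (+ N) (+ toℕ (lookup (f (x ⊞ i)) c)) (A (lookup (x ⊞ i) c)) (A u) (A 0#) (α v) r (+ toℕ j)
                             (A (u ⊕ v)) (cong A (lookup-⊞ x i c)))
        (∣m∣n⇒∣m-n (∣m∣n⇒∣m-n (divides F (ℤ.*-comm (+ N) F)) (α-additive u v)) (α-· (toℕ j) e))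
        where
        u = lookup x c
        j = lookup i c
        v = toℕ j · e
        F = + toℕ (lookup (f (x ⊞ i)) c)
        lemma′ : ∀ N F s a a₀ b r j →
          (N ℤ.* F ℤ.- ((s ℤ.- a₀) ℤ.- ((a ℤ.- a₀) ℤ.+ b))) ℤ.- (b ℤ.- j ℤ.* r) ≡ (N ℤ.* F ℤ.- s) ℤ.- (ℤ.- a ℤ.- r ℤ.* j)
        lemma′ = solve-∀
        lemma : ∀ N F s a a₀ b r j s′ → s ≡ s′ →
          (N ℤ.* F ℤ.- ((s′ ℤ.- a₀) ℤ.- ((a ℤ.- a₀) ℤ.+ b))) ℤ.- (b ℤ.- j ℤ.* r) ≡ (N ℤ.* F ℤ.- s) ℤ.- (ℤ.- a ℤ.- r ℤ.* j)
        lemma N F s a a₀ b r j _ refl = lemma′ N F s a a₀ b r j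

      Label : Set
      Label = Vec (Fin q) n × Vec (Fin q) n × Vec (Fin q) n

      labels : List Label
      labels = cartesianProduct is (cartesianProduct is is)

      triples : List (Triple 𝒜 n)
      triples = cartesianProduct (vectors 𝒜 n) (cartesianProduct (vectors 𝒜 n) (vectors 𝒜 n))

      Balanced : Label → Set
      Balanced (i , j , l) = ∀ c → + q ∣ + toℕ (lookup i c) ℤ.+ + toℕ (lookup j c) ℤ.+ + toℕ (lookup l c)

      balanced? : Decidable Balanced
      balanced? (i , j , l) = all? λ c → + q ∣? (+ toℕ (lookup i c) ℤ.+ + toℕ (lookup j c) ℤ.+ + toℕ (lookup l c))

      shift : Triple 𝒜 n → Label → Triple 𝒜 n
      shift (x , y , z) (i , j , l) = x ⊞ i , y ⊞ j , z ⊞ l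

      zeroSum-lookup : ∀ {x y z} → ZeroSum 𝒜 n (x , y , z) → ∀ c → lookup x c ⊕ lookup y c ⊕ lookup z c ≡ 0#
      zeroSum-lookup {x} {y} {z} h c = begin
        lookup x c ⊕ lookup y c ⊕ lookup z c              ≡⟨ cong (_⊕ lookup z c) (lookup-zipWith _⊕_ c x y) ⟨
        lookup (zipWith _⊕_ x y) c ⊕ lookup z c           ≡⟨ lookup-zipWith _⊕_ c (zipWith _⊕_ x y) z ⟨
        lookup (zipWith _⊕_ (zipWith _⊕_ x y) z) c        ≡⟨ cong (λ v → lookup v c) h ⟩
        lookup (replicate n 0#) c                         ≡⟨ lookup-replicate c 0# ⟩
        0#                                                ∎
        where open ≡-Reasoning

      lookup-zeroSum : ∀ {x y z} → (∀ c → lookup x c ⊕ lookup y c ⊕ lookup z c ≡ 0#) → ZeroSum 𝒜 n (x , y , z)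
      lookup-zeroSum {x} {y} {z} h = lookup-injective λ c → begin
        lookup (zipWith _⊕_ (zipWith _⊕_ x y) z) c        ≡⟨ lookup-zipWith _⊕_ c (zipWith _⊕_ x y) z ⟩
        lookup (zipWith _⊕_ x y) c ⊕ lookup z c           ≡⟨ cong (_⊕ lookup z c) (lookup-zipWith _⊕_ c x y) ⟩
        lookup x c ⊕ lookup y c ⊕ lookup z c              ≡⟨ h c ⟩
        0#                                                ≡⟨ lookup-replicate c 0# ⟨
        lookup (replicate n 0#) c                         ∎
        where open ≡-Reasoning

      balanced-· : ∀ i j l → + q ∣ + i ℤ.+ + j ℤ.+ + l → i · e ⊕ j · e ⊕ l · e ≡ 0#
      balanced-· i j l h = multiple (∣⇒∣ᵤ (subst (+ q ∣_) (sym (pos-+₃ i j l)) h))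
        where
        open ≡-Reasoning
        zero-· : ∀ m → m · 0# ≡ 0#
        zero-· zero    = refl
        zero-· (suc m) = trans (identityˡ _) (zero-· m)
        multiple : q ∣ᵤ i + j + l → i · e ⊕ j · e ⊕ l · e ≡ 0#
        multiple (divides′ m eq) = begin
          i · e ⊕ j · e ⊕ l · e      ≡⟨ cong (_⊕ l · e) (×-homo-+ e i j) ⟨
          (i + j) · e ⊕ l · e        ≡⟨ ×-homo-+ e (i + j) l ⟨
          (i + j + l) · e            ≡⟨ cong (_· e) eq ⟩
          (m * q) · e                ≡⟨ ×-assocˡ e m q ⟨
          m · (q · e)                ≡⟨ cong (m ·_) qe≡0 ⟩
          m · 0#                     ≡⟨ zero-· m ⟩
          0#                         ∎

      shift-zeroSum : ∀ ω λs → Balanced λs → ZeroSum 𝒜 n (shift ω λs) → ZeroSum 𝒜 n ω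
      shift-zeroSum (x , y , z) (i , j , l) bal zs = lookup-zeroSum λ c →
        let xc = lookup x c; yc = lookup y c; zc = lookup z c
            ic = toℕ (lookup i c) · e; jc = toℕ (lookup j c) · e; lc = toℕ (lookup l c) · e
            open ≡-Reasoning in begin
        xc ⊕ yc ⊕ zc                                  ≡⟨ identityʳ _ ⟨
        (xc ⊕ yc ⊕ zc) ⊕ 0#                           ≡⟨ cong (xc ⊕ yc ⊕ zc ⊕_) (balanced-· (toℕ (lookup i c)) (toℕ (lookup j c)) (toℕ (lookup l c)) (bal c)) ⟨
        (xc ⊕ yc ⊕ zc) ⊕ (ic ⊕ jc ⊕ lc)               ≡⟨ interchange (xc ⊕ yc) zc (ic ⊕ jc) lc ⟩
        ((xc ⊕ yc) ⊕ (ic ⊕ jc)) ⊕ (zc ⊕ lc)           ≡⟨ cong (_⊕ (zc ⊕ lc)) (interchange xc yc ic jc) ⟩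
        ((xc ⊕ ic) ⊕ (yc ⊕ jc)) ⊕ (zc ⊕ lc)           ≡⟨ cong₂ _⊕_ (cong₂ _⊕_ (lookup-⊞ x i c) (lookup-⊞ y j c)) (lookup-⊞ z l c) ⟨
        lookup (x ⊞ i) c ⊕ lookup (y ⊞ j) c ⊕ lookup (z ⊞ l) c   ≡⟨ zeroSum-lookup zs c ⟩
        0#                                            ∎

      open AbelianGroup V using (_≈_; _∙_; ε)

      section : Triple 𝒜 n → Label → Fin n → ℤ × ℤ
      section (x , y , z) (i , j , l) =
        labelled (twist f A x) i ∙ labelled (twist g B y) j ∙ labelled (twist h C z) l

      -- N times the winning equation modulo q is an equation modulo qN with the same right-hand
      -- side N t as the one solved by A, B and C; subtracting them gives the second coordinate.
      wins⇒section : ∀ ω λs → Balanced λs → ZeroSum 𝒜 n (shift ω λs) → Wins 𝒜 t f g h (shift ω λs) → section ω λs ≈ ε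
      wins⇒section (x , y , z) (i , j , l) bal zs wins c =
        ∣-by (sym (ℤ.+-identityʳ _)) (bal c) ,
        ∣-by (lemma (+ N) (+ F) (+ G) (+ H) (A x′) (B y′) (C z′) (T x′ y′ z′))
          (∣m∣n⇒∣m-n (subst (_∣ + N ℤ.* ((+ F ℤ.+ + G ℤ.+ + H) ℤ.- T x′ y′ z′)) (trans (ℤ.*-comm (+ N) (+ q)) (sym (ℤ.pos-* q N))) (*-monoʳ-∣ (+ N) win))
            (solves x′ y′ z′ (zeroSum-lookup zs c)))
        where
        x′ = lookup (x ⊞ i) c
        y′ = lookup (y ⊞ j) c
        z′ = lookup (z ⊞ l) c
        F = toℕ (lookup (f (x ⊞ i)) c)
        G = toℕ (lookup (g (y ⊞ j)) c)
        H = toℕ (lookup (h (z ⊞ l)) c)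
        win : + q ∣ (+ F ℤ.+ + G ℤ.+ + H) ℤ.- T x′ y′ z′
        win = ∣-by (cong (ℤ._- T x′ y′ z′) (pos-+₃ F G H)) (mod⇒∣ (F + G + H) (toℕ (t x′ y′ z′)) (wins c))
        lemma : ∀ N F G H a b c T →
          N ℤ.* ((F ℤ.+ G ℤ.+ H) ℤ.- T) ℤ.- ((a ℤ.+ b ℤ.+ c) ℤ.- N ℤ.* T)
          ≡ ((N ℤ.* F ℤ.- a) ℤ.+ (N ℤ.* G ℤ.- b) ℤ.+ (N ℤ.* H ℤ.- c)) ℤ.- 0ℤ
        lemma = solve-∀

      solutions-at : Triple 𝒜 n → ℕ
      solutions-at (x , y , z) = solutions N>0 (twist f A x) (twist g B y) (twist h C z) (λ c → ℤ.- A (lookup x c)) (twisted x)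

      solutions-at-alt : ∀ ω → solutions-at ω ≡ (∑[ λs ∈ labels ] χ (section ω λs ≈? ε))
      solutions-at-alt (x , y , z) = sym (trans (∑-cartesian is (cartesianProduct is is) _)
        (∑-cong is λ i → ∑-cartesian is is _))

      zs? = zeroSum? 𝒜 n
      win? = wins? 𝒜 t f g h

      won : Triple 𝒜 n → ℕ
      won ω = χ (zs? ω) * χ (win? ω)

      winning : ℕ
      winning = length (filter win? (zeroSumTriples 𝒜 n))

      winning-alt : winning ≡ ∑ triples won
      winning-alt = trans (length-filter-∑ win? (zeroSumTriples 𝒜 n)) (∑-filter zs? triples _)

      ∑-shift : ∀ λs (G : Triple 𝒜 n → ℕ) → ∑ triples G ≤ (∑[ ω ∈ triples ] G (shift ω λs))
      ∑-shift (i , j , l) G = begin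
        ∑ triples G                                                            ≡⟨ nested G ⟩
        (∑[ x ∈ vs ] ∑[ y ∈ vs ] ∑[ z ∈ vs ] G (x , y , z))                    ≤⟨ reindex i _ ⟩
        (∑[ x ∈ vs ] ∑[ y ∈ vs ] ∑[ z ∈ vs ] G (x ⊞ i , y , z))                ≤⟨ ∑-mono vs (λ x → reindex j _) ⟩
        (∑[ x ∈ vs ] ∑[ y ∈ vs ] ∑[ z ∈ vs ] G (x ⊞ i , y ⊞ j , z))            ≤⟨ ∑-mono vs (λ x → ∑-mono vs λ y → reindex l _) ⟩
        (∑[ x ∈ vs ] ∑[ y ∈ vs ] ∑[ z ∈ vs ] G (x ⊞ i , y ⊞ j , z ⊞ l))        ≡⟨ nested (λ ω → G (shift ω (i , j , l))) ⟨
        (∑[ ω ∈ triples ] G (shift ω (i , j , l)))                             ∎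
        where
        open ≤-Reasoning
        vs = vectors 𝒜 n
        nested : ∀ (G : Triple 𝒜 n → ℕ) → ∑ triples G ≡ (∑[ x ∈ vs ] ∑[ y ∈ vs ] ∑[ z ∈ vs ] G (x , y , z))
        nested G = trans (∑-cartesian vs (cartesianProduct vs vs) G) (∑-cong vs λ x → ∑-cartesian vs vs _)
        reindex : ∀ i (g : Vec Carrier n → ℕ) → ∑ vs g ≤ (∑[ x ∈ vs ] g (x ⊞ i))
        reindex i = ∑-reindex (≡-dec _≟_) (∈-vectors 𝒜) (vectors-unique n) (_⊞ i) (_⊟ i) (⊟-⊞ i)

      -- Two labels are free, and the third is the residue of minus their sum.
      balanced-count : q ^ n * q ^ n ≤ (∑[ λs ∈ labels ] χ (balanced? λs))
      balanced-count = begin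
        q ^ n * q ^ n                                                        ≡⟨ cong₂ _*_ |is| |is| ⟨
        length is * length is                                                ≡⟨ cong (length is *_) (*-identityʳ _) ⟨
        length is * (length is * 1)                                          ≡⟨ cong (length is *_) (∑-const is 1) ⟨
        length is * (∑[ _ ∈ is ] 1)                                          ≡⟨ ∑-const is _ ⟨
        (∑[ i ∈ is ] ∑[ j ∈ is ] 1)                                          ≤⟨ ∑-mono is (λ i → ∑-mono is (complete i)) ⟩
        (∑[ i ∈ is ] ∑[ j ∈ is ] ∑[ l ∈ is ] χ (balanced? (i , j , l)))      ≡⟨ trans (∑-cartesian is (cartesianProduct is is) _)
          (∑-cong is λ i → ∑-cartesian is is _) ⟨
        (∑[ λs ∈ labels ] χ (balanced? λs))                                  ∎
        where
        open ≤-Reasoning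
        complete : ∀ i j → 1 ≤ (∑[ l ∈ is ] χ (balanced? (i , j , l)))
        complete i j = ≤-trans (≤-reflexive (sym (χ-yes (balanced? (i , j , l₀)) balanced)))
          (∑-∈ (λ l → χ (balanced? (i , j , l))) (∈-tuples ∈-allFin l₀))
          where
          s : Fin n → ℤ
          s c = + toℕ (lookup i c) ℤ.+ + toℕ (lookup j c)
          l₀ = tabulate λ c → residue q (ℤ.- s c)
          balanced : Balanced (i , j , l₀)
          balanced c = subst (λ l → + q ∣ s c ℤ.+ + toℕ l) (sym (lookup∘tabulate _ c))
            (∣-by (lemma (s c) (+ toℕ (residue q (ℤ.- s c)))) (residue-∣ q (ℤ.- s c)))
            where
            lemma : ∀ s m → m ℤ.- ℤ.- s ≡ s ℤ.+ m
            lemma = solve-∀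

      -- Double counting of triples and balanced labels whose shift is a winning zero-sum triple.
      -- For a fixed label the shift is onto; for a fixed triple these labels are zeros of the three
      -- sections.
      averaging : q ^ n * q ^ n * winning ≤ (∑[ ω ∈ zeroSumTriples 𝒜 n ] solutions-at ω)
      averaging = begin
        q ^ n * q ^ n * winning                                               ≤⟨ *-monoˡ-≤ winning balanced-count ⟩
        (∑[ λs ∈ labels ] χ (balanced? λs)) * winning                         ≡⟨ ∑-*ʳ labels _ winning ⟩
        (∑[ λs ∈ labels ] χ (balanced? λs) * winning)
          ≤⟨ ∑-mono labels (λ λs → *-monoʳ-≤ (χ (balanced? λs)) (≤-trans (≤-reflexive winning-alt) (∑-shift λs won))) ⟩
        (∑[ λs ∈ labels ] χ (balanced? λs) * (∑[ ω ∈ triples ] won (shift ω λs)))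
          ≡⟨ ∑-cong labels (λ λs → ∑-*ˡ (χ (balanced? λs)) triples _) ⟩
        (∑[ λs ∈ labels ] ∑[ ω ∈ triples ] χ (balanced? λs) * won (shift ω λs))
          ≤⟨ ∑-mono labels (λ λs → ∑-mono triples (λ ω → transfer λs ω)) ⟩
        (∑[ λs ∈ labels ] ∑[ ω ∈ triples ] χ (zs? ω) * χ (section ω λs ≈? ε))
          ≡⟨ ∑-swap labels triples _ ⟩
        (∑[ ω ∈ triples ] ∑[ λs ∈ labels ] χ (zs? ω) * χ (section ω λs ≈? ε))
          ≡⟨ ∑-cong triples (λ ω → trans (cong (χ (zs? ω) *_) (solutions-at-alt ω)) (∑-*ˡ (χ (zs? ω)) labels _)) ⟨
        (∑[ ω ∈ triples ] χ (zs? ω) * solutions-at ω)                         ≡⟨ ∑-filter zs? triples solutions-at ⟨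
        (∑[ ω ∈ zeroSumTriples 𝒜 n ] solutions-at ω)                          ∎
        where
        open ≤-Reasoning
        transfer : ∀ λs ω → χ (balanced? λs) * won (shift ω λs) ≤ χ (zs? ω) * χ (section ω λs ≈? ε)
        transfer λs ω with balanced? λs
        ... | no _    = z≤n
        ... | yes bal with zs? (shift ω λs)
        ...   | no _   = z≤n
        ...   | yes zs with win? (shift ω λs)
        ...     | no _     = z≤n
        ...     | yes wins = ≤-reflexive (sym (cong₂ _*_ (χ-yes (zs? ω) (shift-zeroSum ω λs bal zs))
                               (χ-yes (section ω λs ≈? ε) (wins⇒section ω λs bal zs wins))))

      winning-bound : 2 ^ n * winning ^ (8 * 2 ^ q) ≤ length (zeroSumTriples 𝒜 n) ^ (8 * 2 ^ q)
      winning-bound = *-cancelˡ-≤ (B′ ^ k) {{m^n≢0 B′ k {{m*n≢0 (q ^ n) (q ^ n) {{m^n≢0 q n}} {{m^n≢0 q n}}}}}} (begin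
        B′ ^ k * (2 ^ n * winning ^ k)      ≡⟨ regroup (B′ ^ k) (2 ^ n) (winning ^ k) ⟩
        2 ^ n * (B′ ^ k * winning ^ k)      ≡⟨ cong (2 ^ n *_) (^-distribʳ-* k B′ winning) ⟨
        2 ^ n * (B′ * winning) ^ k          ≤⟨ *-monoʳ-≤ (2 ^ n) (^-monoˡ-≤ k averaging) ⟩
        2 ^ n * ∑ Ω solutions-at ^ k        ≤⟨ ∑-power-≤ Ω {{zeroSumTriples-nonZero 𝒜 {n}}} solutions-at k {B′} {2 ^ n}
          (λ { (x , y , z) → solutions-bound N>0 (twist f A x) (twist g B y) (twist h C z) (λ c → ℤ.- A (lookup x c)) (twisted x) }) ⟩
        (length Ω * B′) ^ k                 ≡⟨ trans (^-distribʳ-* k (length Ω) B′) (*-comm (length Ω ^ k) (B′ ^ k)) ⟩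
        B′ ^ k * length Ω ^ k               ∎)
        where
        open ≤-Reasoning
        k = 8 * 2 ^ q
        B′ = q ^ n * q ^ n
        Ω = zeroSumTriples 𝒜 n
        regroup : ∀ a b c → a * (b * c) ≡ b * (a * c)
        regroup = ℕ-Solver.solve-∀

    winProbability-decay : ∀ p k → Prime p → (t : Carrier → Carrier → Carrier → ℤ/ (p ^ suc k)) (N : ℕ) →
      IsMinimalSolvable 𝒜 (p ^ suc k) t N → 1 < N → ∀ n (f g h : Vec Carrier n → Vec (ℤ/ (p ^ suc k)) n) →
      winProbability 𝒜 t f g h ≤2^-[ decayRate (p ^ suc k) · n ]
    winProbability-decay p k p-prime t N (N>0 , solution , minimal) 1<N n f g h =
      -- `decayRate` has numerator 1 and denominator suc (pred K), whence the exponents 1 * n and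
      -- suc (pred K).
      pow-≤1 winning (length (zeroSumTriples 𝒜 n)) {{zeroSumTriples-nonZero 𝒜 {n}}} (suc (pred K)) (2 ^ (1 * n))
        (subst₂ (λ m K → 2 ^ m * winning ^ K ≤ length (zeroSumTriples 𝒜 n) ^ K)
          (sym (*-identityˡ n)) (sym (suc-pred K {{m*n≢0 8 (2 ^ q) {{_}} {{m^n≢0 2 q}}}})) winning-bound)
      where
      q K : ℕ
      q = p ^ suc k
      K = 8 * 2 ^ q

      instance
        q≢0 : NonZero q
        q≢0 = m^n≢0 p (suc k) {{prime⇒nonZero p-prime}}

      witness = nonLiftable 𝒜 p k N p-prime t N>0 solution λ solvable → <⇒≱ 1<N (minimal 1 (s≤s z≤n) solvable)

      open Averaging q N t N>0 solution (proj₁ witness) (proj₁ (proj₂ witness)) (proj₂ (proj₂ witness)) n f g h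

open Averages

open FiniteAbelianGroup using (Carrier)

theorem2p4 : ∀ {a : Level} (𝒜 : FiniteAbelianGroup a) (p k : ℕ) → Prime p → 1 ≤ k →
    (t : Carrier 𝒜 → Carrier 𝒜 → Carrier 𝒜 → ℤ/ (p ^ k)) →
    (N : ℕ) → IsMinimalSolvable 𝒜 (p ^ k) t N → 1 < N →
    Σ[ c ∈ ℚ ] (0ℚ ℚ.< c ×
    (∀ (n : ℕ) (f g h : Vec (Carrier 𝒜) n → Vec (ℤ/ (p ^ k)) n) →
    winProbability 𝒜 t f g h ≤2^-[ c · n ]))
theorem2p4 𝒜 p (suc k) p-prime _ t N minimal 1<N =
  decayRate (p ^ suc k) , decayRate-positive (p ^ suc k) , winProbability-decay 𝒜 p k p-prime t N minimal 1<N
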